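{- Let $(G,u)$ and $(H,v)$ be rooted graphs. For integers $g,h\ge 0$ and $m\ge 2$, let $K_m^{gh}(G,H)$ be the graph obtained from disjoint copies of $G$, $K_m$ and $H$ by choosing two distinct vertices $x,y$ of $K_m$, adding a path of length $g$ linking $u$ and $x$, and adding a path of length $h$ linking $y$ and $v$ (a path of length $0$ means the two vertices are identified). Then \[ \frac{X_{K_m^{gh}(G,H)}}{(m-2)!}=\sum_{z=1}^{m-1}z\,e_{m-1-z}\,X_{P^{g+h+z}(G,H)}+(m-2)\sum_{\substack{a+b+c=m-2\\ a,b,c\ge 0}}(a-1)\,e_a\,X_{G^{b+g}}\,X_{H^{c+h}}. \]
   Context: All graphs are finite simple graphs; $X_G=\sum_{\kappa}\prod_{v\in V(G)}x_{\kappa(v)}$ over proper colorings $\kappa:V(G)\to\{1,2,\dots\}$ is the chromatic symmetric function; $e_a$ is the $a$-th elementary symmetric function, $e_0=1$. For rooted graphs $(G,u),(H,v)$ and $k\ge 0$, $P^k(G,H)$ is obtained from disjoint copies of $G,H$ by adding a path of length $k$ linking $u$ and $v$ (identifying them if $k=0$); the tailed graph is $G^k=P^k(G,K_1)$. -}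

module Defs where

open import Data.Nat as ℕ using (ℕ; zero; suc; _∸_; _≤ᵇ_; _≡ᵇ_)
open import Data.Fin as Fin using (Fin; zero; suc; _↑ˡ_; _↑ʳ_; punchOut; fromℕ; toℕ)
open import Data.Bool using (Bool; true; false; not; _∧_; if_then_else_)
open import Data.List using (List; []; _∷_; [_]; map; concatMap; _++_; length; lookup; upTo; foldr; filterᵇ; cartesianProduct)
open import Data.Bool.ListAction using (and)
open import Data.Nat.ListAction using (sum)
open import Data.List.Relation.Unary.All using (All)
open import Data.Vec as Vec using (Vec; []; _∷_)
open import Data.Product using (_×_; _,_; proj₁; proj₂)
open import Data.Integer as ℤ using (ℤ; +_)
open import Relation.Nullary using (does; yes; no)
open import Relation.Binary.PropositionalEquality using (_≢_)

-- Graphs on the vertex set Fin n, given by a list of edges.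
-- A finite simple graph is represented by a loopless edge list
-- (orientation / repetition of edges is irrelevant for colourings).

Graph : ℕ → Set
Graph n = List (Fin n × Fin n)

Simple : ∀ {n} → Graph n → Set
Simple G = All (λ e → proj₁ e ≢ proj₂ e) G

-- Gluing: disjoint union of G and H with vertex s of H identified
-- with vertex r of G.  Vertices of G keep their indices; the other
-- vertices of H are placed after them.
embL : ∀ {a} b → Fin a → Fin (a ℕ.+ b)
embL b i = i ↑ˡ b

embR : ∀ {a b} → Fin a → Fin (suc b) → Fin (suc b) → Fin (a ℕ.+ b)
embR {a} {b} r s w with w Fin.≟ s
... | yes _   = r ↑ˡ b
... | no  w≢s = a ↑ʳ (punchOut {i = s} {j = w} (λ eq → w≢s (Relation.Binary.PropositionalEquality.sym eq)))
  where import Relation.Binary.PropositionalEquality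

glue : ∀ {a b} → Graph a → Fin a → Graph (suc b) → Fin (suc b) → Graph (a ℕ.+ b)
glue {a} {b} G r H s =
  map (λ e → embL b (proj₁ e) , embL b (proj₂ e)) G
  ++ map (λ e → embR r s (proj₁ e) , embR r s (proj₂ e)) H

Path : (k : ℕ) → Graph (suc k)
Path k = map (λ i → Fin.inject₁ i , suc i) (Data.List.allFin k)
  where import Data.List

Complete : (m : ℕ) → Graph m
Complete m = filterᵇ (λ e → suc (toℕ (proj₁ e)) ≤ᵇ toℕ (proj₂ e))
                     (cartesianProduct (Data.List.allFin m) (Data.List.allFin m))
  where import Data.List

PkSize : ℕ → ℕ → ℕ → ℕ
PkSize a k b = suc a ℕ.+ k ℕ.+ b

Pk : ∀ {a b} → Graph (suc a) → Fin (suc a) → Graph (suc b) → Fin (suc b)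
   → (k : ℕ) → Graph (PkSize a k b)
Pk G u H v k = glue (glue G u (Path k) zero) (embR u zero (fromℕ k)) H v

PkEmbR : ∀ {a b} → Fin (suc a) → Fin (suc b) → (k : ℕ)
       → Fin (suc b) → Fin (PkSize a k b)
PkEmbR u v k = embR (embR u zero (fromℕ k)) v

K1 : Graph 1
K1 = []

Tail : ∀ {a} → Graph (suc a) → Fin (suc a) → (k : ℕ) → Graph (PkSize a k 0)
Tail G u k = Pk G u K1 zero k

Kgh : ∀ {a b} (m' : ℕ) → Graph (suc a) → Fin (suc a) → Graph (suc b) → Fin (suc b)
    → (x y : Fin (suc (suc m'))) → (g h : ℕ)
    → Graph (PkSize (a ℕ.+ g ℕ.+ suc m') h b)
Kgh m' G u H v x y g h =
  Pk (Pk G u (Complete (suc (suc m'))) x g) (PkEmbR u x g y) H v h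

-- Symmetric functions as formal power series in x_1, x_2, ... with
-- integer coefficients: a series is its coefficient function on
-- monomials x^α, where a monomial is an exponent list α
-- (α_i = exponent of x_{i+1}; trailing zeros do not matter).

allᵇ : {A : Set} → (A → Bool) → List A → Bool
allᵇ p xs = and (map p xs)

SF : Set
SF = List ℕ → ℤ

_⊕_ : SF → SF → SF
(f ⊕ g) α = f α ℤ.+ g α

_·_ : ℤ → SF → SF
(c · f) α = c ℤ.* f α

zeroSF : SF
zeroSF _ = + 0

ΣSF : {A : Set} → List A → (A → SF) → SF
ΣSF xs f = foldr (λ x acc → f x ⊕ acc) zeroSF xs

sumℤ : List ℤ → ℤ
sumℤ = foldr ℤ._+_ (+ 0)

splits : List ℕ → List (List ℕ × List ℕ)
splits [] = [ ([] , []) ]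
splits (k ∷ α) = concatMap (λ i → map (λ p → (i ∷ proj₁ p) , ((k ∸ i) ∷ proj₂ p)) (splits α))
                           (upTo (suc k))

_⊗_ : SF → SF → SF
(f ⊗ g) α = sumℤ (map (λ p → f (proj₁ p) ℤ.* g (proj₂ p)) (splits α))

e : ℕ → SF
e a α = if allᵇ (λ k → k ≤ᵇ 1) α ∧ (sum α ≡ᵇ a) then + 1 else + 0

-- chromatic symmetric function: coefficient of x^α is the number of
-- proper colourings κ with |κ⁻¹(i)| = α_i for every colour i
-- (colours ≥ length α cannot occur in such a colouring).
allVecs : (n L : ℕ) → List (Vec (Fin L) n)
allVecs zero L = [ [] ]
allVecs (suc n) L = concatMap (λ c → map (c ∷_) (allVecs n L)) (Data.List.allFin L)
  where import Data.List

proper : ∀ {n L} → Graph n → Vec (Fin L) n → Bool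
proper G κ = allᵇ (λ e → not (does (Vec.lookup κ (proj₁ e) Fin.≟ Vec.lookup κ (proj₂ e)))) G

countᵇ : {A : Set} → (A → Bool) → List A → ℕ
countᵇ p xs = length (filterᵇ p xs)

fibresOK : ∀ {n} (α : List ℕ) → Vec (Fin (length α)) n → Bool
fibresOK {n} α κ =
  allᵇ (λ i → countᵇ (λ w → does (Vec.lookup κ w Fin.≟ i)) (Data.List.allFin n) ≡ᵇ lookup α i)
      (Data.List.allFin (length α))
  where import Data.List

X : ∀ {n} → Graph n → SF
X {n} G α = + countᵇ (λ κ → proper G κ ∧ fibresOK α κ) (allVecs n (length α))

triples : ℕ → List (ℕ × ℕ × ℕ)
triples n = concatMap (λ i → map (λ j → i , j , (n ∸ i ∸ j)) (upTo (suc (n ∸ i)))) (upTo (suc n))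

module Submission where

-- Let x_1, …, x_L be the variables, let F_c be the generating function of the colourings of G in
-- which u has colour c, without the factor x_c of u, and let K_c be the same for H.  Lengthening a
-- path by one edge applies T, where (T F)_c = Σ_{d ≠ c} x_d F_d, so with ⟨F, K⟩ = Σ_c x_c F_c K_c
-- the graph P^k(G,H) has chromatic function ⟨T^k F, K⟩ and G^k has s(T^k F), where
-- s(F) = Σ_c x_c F_c.  Taking g and h to be absorbed in F and K, a clique contributes
-- (m-2)! Σ_{c ≠ d} x_c F_c x_d K_d e_{m-2}(x without x_c, x_d).
-- Now sum over m with a variable t.  Put E = ∏ (1 + x_c t), I_c = 1 / (1 + x_c t), A = Σ x_c I_c,
-- f = Σ x_c F_c I_c, k = Σ x_c K_c I_c, C = Σ x_c² F_c K_c I_c² and θ = t d/dt.  The clique sums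
-- become Q = E (f k - C), since deleting x_c from E is multiplication by I_c.  From
-- (T F)_c + x_c F_c = s(F) one gets Σ T^n F_c tⁿ = I_c (F_c + t s_F) with s_F = Σ s(T^n F) tⁿ,
-- hence s_F = f + t s_F A and Σ ⟨T^n F, K⟩ tⁿ = B + t s_F k, where B = Σ x_c F_c K_c I_c satisfies
-- θ B = - t C.  Together with θ E = t E A this gives
-- t Q = E θ(Σ ⟨T^n F, K⟩ tⁿ) + t θ((θ E - E) s_F s_K), and the coefficient of t^{m-1} is the theorem.

open import Algebra.Bundles using (CommutativeRing)
open import Data.Bool using (Bool; true; false; not; _∧_; _∨_; if_then_else_)
open import Data.Bool.Properties using (∧-assoc; ∧-zeroʳ; ∧-commutativeMonoid)
open import Data.Fin using (Fin; zero; suc; _≟_; punchIn; punchOut; fromℕ; toℕ; inject₁)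
open import Data.Fin.Properties using (punchIn-punchOut)
open import Data.List as List using (List; []; _∷_; map; concatMap; _++_; length; allFin; tabulate; filterᵇ;
  cartesianProduct; upTo; applyUpTo; foldr)
open import Data.List.Properties using (map-applyUpTo; map-tabulate)
open import Data.Nat as ℕ using (ℕ; zero; suc; _∸_; _≡ᵇ_; _≤ᵇ_; _!)
import Data.Nat.Properties as ℕₚ
open import Data.Nat.Solver using (module +-*-Solver)
open import Data.Product using (_×_; _,_; proj₁; proj₂)
open import Data.Vec as Vec using (Vec; []; _∷_; lookup; insertAt)
open import Data.Vec.Properties using (insertAt-lookup; insertAt-punchIn; lookup-++ˡ; lookup-++ʳ)
open import Function using (_∘_)
open import Level using (0ℓ)
open import Relation.Nullary using (does; yes; no)
open import Relation.Binary.PropositionalEquality as ≡ using (_≡_; _≢_)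
import Algebra.Construct.Pointwise as Pointwise
import Algebra.Properties.CommutativeSemigroup as CommutativeSemigroupProperties
import Algebra.Properties.Group as GroupProperties
import Algebra.Properties.Ring as RingProperties
import Algebra.Properties.Semiring.Mult as SemiringMult
import Algebra.Properties.Semiring.Sum as SemiringSum
import Algebra.Solver.CommutativeMonoid as CommutativeMonoidSolver
import Algebra.Solver.Ring.NaturalCoefficients.Default as SemiringSolver
import Relation.Binary.Reasoning.Setoid as SetoidReasoning
open import Defs hiding (X; e)

-- Formal power series over a commutative ring and the operator t d/dt.

module PowerSeries (R : CommutativeRing 0ℓ 0ℓ) where
  open CommutativeRing R hiding (zero)
  open SetoidReasoning setoid
  open CommutativeSemigroupProperties +-commutativeSemigroup using (interchange; x∙yz≈y∙xz)
  open SemiringMult semiring using (×-comm-*; ×-congʳ) renaming (_×_ to _·ₙ_)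

  Series : Set
  Series = ℕ → Carrier

  infix 4 _≋_
  _≋_ : Series → Series → Set
  f ≋ g = ∀ n → f n ≈ g n

  infixl 7 _⊛_
  -- The Cauchy product, by recursion along f = f 0 + t f′. This form lets most ring laws be proved
  -- by induction on the degree, without indexed sums.
  _⊛_ : Series → Series → Series
  (f ⊛ g) zero    = f 0 * g 0
  (f ⊛ g) (suc n) = f 0 * g (suc n) + ((f ∘ suc) ⊛ g) n

  const : Carrier → Series
  const a zero    = a
  const a (suc n) = 0#

  shift : Series → Series
  shift f zero    = 0#
  shift f (suc n) = f n

  ⊛-cong : ∀ {f f′ g g′} → f ≋ f′ → g ≋ g′ → f ⊛ g ≋ f′ ⊛ g′
  ⊛-cong p q zero    = *-cong (p 0) (q 0)
  ⊛-cong p q (suc n) = +-cong (*-cong (p 0) (q (suc n))) (⊛-cong (p ∘ suc) q n)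

  ⊛-zeroˡ : ∀ f {z} → (∀ n → z n ≈ 0#) → ∀ n → (z ⊛ f) n ≈ 0#
  ⊛-zeroˡ f z≈0 zero    = trans (*-congʳ (z≈0 0)) (zeroˡ _)
  ⊛-zeroˡ f z≈0 (suc n) = trans
    (+-cong (trans (*-congʳ (z≈0 0)) (zeroˡ _)) (⊛-zeroˡ f (z≈0 ∘ suc) n)) (+-identityˡ 0#)

  const-⊛ : ∀ a f n → (const a ⊛ f) n ≈ a * f n
  const-⊛ a f zero    = refl
  const-⊛ a f (suc n) = trans (+-congˡ (⊛-zeroˡ f (λ _ → refl) n)) (+-identityʳ _)

  ⊛-distribʳ : ∀ h f g → (λ n → f n + g n) ⊛ h ≋ (λ n → (f ⊛ h) n + (g ⊛ h) n)
  ⊛-distribʳ h f g zero    = distribʳ _ _ _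
  ⊛-distribʳ h f g (suc n) = trans
    (+-cong (distribʳ _ _ _) (⊛-distribʳ h (f ∘ suc) (g ∘ suc) n)) (interchange _ _ _ _)

  ⊛-scaleˡ : ∀ a f g n → ((λ i → a * f i) ⊛ g) n ≈ a * (f ⊛ g) n
  ⊛-scaleˡ a f g zero    = *-assoc _ _ _
  ⊛-scaleˡ a f g (suc n) = trans
    (+-cong (*-assoc _ _ _) (⊛-scaleˡ a (f ∘ suc) g n)) (sym (distribˡ _ _ _))

  ⊛-assoc : ∀ f g h → (f ⊛ g) ⊛ h ≋ f ⊛ (g ⊛ h)
  ⊛-assoc f g h zero    = *-assoc _ _ _
  ⊛-assoc f g h (suc n) = begin
    f 0 * g 0 * h (suc n) + (((f ⊛ g) ∘ suc) ⊛ h) n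
      ≈⟨ +-cong (*-assoc _ _ _) (⊛-distribʳ h (λ i → f 0 * g (suc i)) ((f ∘ suc) ⊛ g) n) ⟩
    f 0 * (g 0 * h (suc n)) + (((λ i → f 0 * g (suc i)) ⊛ h) n + (((f ∘ suc) ⊛ g) ⊛ h) n)
      ≈⟨ +-congˡ (+-cong (⊛-scaleˡ (f 0) (g ∘ suc) h n) (⊛-assoc (f ∘ suc) g h n)) ⟩
    f 0 * (g 0 * h (suc n)) + (f 0 * ((g ∘ suc) ⊛ h) n + ((f ∘ suc) ⊛ (g ⊛ h)) n)
      ≈⟨ +-assoc _ _ _ ⟨
    f 0 * (g 0 * h (suc n)) + f 0 * ((g ∘ suc) ⊛ h) n + ((f ∘ suc) ⊛ (g ⊛ h)) n
      ≈⟨ +-congʳ (distribˡ _ _ _) ⟨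
    f 0 * (g ⊛ h) (suc n) + ((f ∘ suc) ⊛ (g ⊛ h)) n ∎

  -- The mirror image of the defining recursion, expanding the right factor first. Comparing the two
  -- expansions yields commutativity.
  ⊛-unfoldʳ : ∀ f g n → (f ⊛ g) (suc n) ≈ g 0 * f (suc n) + (f ⊛ (g ∘ suc)) n
  ⊛-unfoldʳ f g zero    = trans (+-comm _ _) (+-congʳ (*-comm _ _))
  ⊛-unfoldʳ f g (suc n) = trans (+-congˡ (⊛-unfoldʳ (f ∘ suc) g n)) (x∙yz≈y∙xz _ _ _)

  ⊛-comm : ∀ f g → f ⊛ g ≋ g ⊛ f
  ⊛-comm f g zero    = *-comm _ _
  ⊛-comm f g (suc n) = trans (⊛-unfoldʳ f g n) (+-congˡ (⊛-comm f (g ∘ suc) n))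

  ⊛-identityˡ : ∀ f → const 1# ⊛ f ≋ f
  ⊛-identityˡ f n = trans (const-⊛ 1# f n) (*-identityˡ _)

  series : CommutativeRing 0ℓ 0ℓ
  series = record
    { Carrier = Series
    ; _≈_     = _≋_
    ; _+_     = λ f g n → f n + g n
    ; _*_     = _⊛_
    ; -_      = λ f n → - f n
    ; 0#      = λ _ → 0#
    ; 1#      = const 1#
    ; isCommutativeRing = record
      { isRing = record
        { +-isAbelianGroup = Pointwise.isAbelianGroup ℕ +-isAbelianGroup
        ; *-cong     = ⊛-cong
        ; *-assoc    = ⊛-assoc
        ; *-identity = ⊛-identityˡ
                     , λ f n → trans (⊛-comm f (const 1#) n) (⊛-identityˡ f n)
        ; distrib    = (λ f g h n → trans (⊛-comm f _ n)
                          (trans (⊛-distribʳ f g h n) (+-cong (⊛-comm g f n) (⊛-comm h f n))))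
                     , ⊛-distribʳ
        }
      ; *-comm = ⊛-comm
      }
    }

  var : Series
  var = shift (const 1#)

  var-⊛ : ∀ f → var ⊛ f ≋ shift f
  var-⊛ f zero    = zeroˡ _
  var-⊛ f (suc n) = trans (+-cong (zeroˡ _) (⊛-identityˡ f n)) (+-identityˡ _)

  θ : Series → Series
  θ f n = n ·ₙ f n

  θ-cong : ∀ {f g} → f ≋ g → θ f ≋ θ g
  θ-cong p n = ×-congʳ n (p n)

  ×-distrib-+ : ∀ n a b → n ·ₙ (a + b) ≈ n ·ₙ a + n ·ₙ b
  ×-distrib-+ zero    a b = sym (+-identityˡ 0#)
  ×-distrib-+ (suc n) a b = trans (+-congˡ (×-distrib-+ n a b)) (interchange _ _ _ _)

  ×-zeroʳ : ∀ n → n ·ₙ 0# ≈ 0#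
  ×-zeroʳ zero    = refl
  ×-zeroʳ (suc n) = trans (+-identityˡ _) (×-zeroʳ n)

  θ-+ : ∀ f g n → θ (λ i → f i + g i) n ≈ θ f n + θ g n
  θ-+ f g n = ×-distrib-+ n (f n) (g n)

  -- The Leibniz rule, by induction on the degree. The multiplier `suc n` on the tail product splits
  -- as 1 + n: the part n is the induction hypothesis, and the extra 1 turns `θ (f ∘ suc)` into
  -- `θ f ∘ suc`.
  θ-⊛ : ∀ f g n → θ (f ⊛ g) n ≈ (θ f ⊛ g) n + (f ⊛ θ g) n
  θ-⊛ f g zero    = sym (trans (+-cong (zeroˡ _) (zeroʳ _)) (+-identityˡ 0#))
  θ-⊛ f g (suc n) = begin
    suc n ·ₙ (f 0 * g (suc n) + f′g)
      ≈⟨ ×-distrib-+ (suc n) _ _ ⟩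
    suc n ·ₙ (f 0 * g (suc n)) + (f′g + n ·ₙ f′g)
      ≈⟨ +-cong (sym (×-comm-* (suc n) _ _)) (+-congˡ (θ-⊛ (f ∘ suc) g n)) ⟩
    f 0 * θ g (suc n) + (f′g + ((θ (f ∘ suc) ⊛ g) n + ((f ∘ suc) ⊛ θ g) n))
      ≈⟨ +-congˡ (+-assoc _ _ _) ⟨
    f 0 * θ g (suc n) + (f′g + (θ (f ∘ suc) ⊛ g) n + ((f ∘ suc) ⊛ θ g) n)
      ≈⟨ x∙yz≈y∙xz _ _ _ ⟩
    f′g + (θ (f ∘ suc) ⊛ g) n + (f ⊛ θ g) (suc n)
      ≈⟨ +-congʳ (⊛-distribʳ g (f ∘ suc) (θ (f ∘ suc)) n) ⟨
    ((θ f ∘ suc) ⊛ g) n + (f ⊛ θ g) (suc n)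
      ≈⟨ +-congʳ (trans (+-congʳ (zeroˡ _)) (+-identityˡ _)) ⟨
    (θ f ⊛ g) (suc n) + (f ⊛ θ g) (suc n) ∎
    where f′g = ((f ∘ suc) ⊛ g) n

  θ-const : ∀ a n → θ (const a) n ≈ 0#
  θ-const a zero    = refl
  θ-const a (suc n) = ×-zeroʳ (suc n)

  θ-var : θ var ≋ var
  θ-var zero          = refl
  θ-var (suc zero)    = +-identityʳ _
  θ-var (suc (suc n)) = ×-zeroʳ (suc (suc n))

-- Indicators and sums over distinct colours.

_≁_ : ∀ {n} → Fin n → Fin n → Bool
c ≁ d = not (does (c ≟ d))

module Indicator (R : CommutativeRing 0ℓ 0ℓ) where
  open CommutativeRing R hiding (zero)
  open SemiringSum semiring public
    using (sum; sum-cong-≋; ∑-distrib-+; ∑-comm; *-distribˡ-sum; *-distribʳ-sum; sum-syntax)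
  open SetoidReasoning setoid

  ind : Bool → Carrier
  ind true  = 1#
  ind false = 0#

  ind-∧ : ∀ a b → ind (a ∧ b) ≈ ind a * ind b
  ind-∧ true  b = sym (*-identityˡ _)
  ind-∧ false b = sym (zeroˡ _)

  sum-ind-true : ∀ {n} (ψ : Fin n → Carrier) → ∑[ d < n ] (1# * ψ d) ≈ sum ψ
  sum-ind-true ψ = sum-cong-≋ (λ d → *-identityˡ (ψ d))

  -- The diagonal term is added on the left rather than subtracted on the right, which keeps the
  -- later computations within reach of the semiring solver.
  sum-off-diagonal : ∀ {n} (c : Fin n) (ψ : Fin n → Carrier) →
    ∑[ d < n ] (ind (c ≁ d) * ψ d) + ψ c ≈ sum ψ
  sum-off-diagonal {suc n} zero ψ = begin
    0# * ψ zero + ∑[ d < n ] (1# * ψ (suc d)) + ψ zero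
      ≈⟨ +-congʳ (trans (+-cong (zeroˡ _) (sum-ind-true (ψ ∘ suc))) (+-identityˡ _)) ⟩
    sum (ψ ∘ suc) + ψ zero ≈⟨ +-comm _ _ ⟩
    sum ψ ∎
  sum-off-diagonal {suc n} (suc c) ψ = begin
    1# * ψ zero + ∑[ d < n ] (ind (c ≁ d) * ψ (suc d)) + ψ (suc c)
      ≈⟨ +-assoc _ _ _ ⟩
    1# * ψ zero + (∑[ d < n ] (ind (c ≁ d) * ψ (suc d)) + ψ (suc c))
      ≈⟨ +-cong (*-identityˡ _) (sum-off-diagonal c (ψ ∘ suc)) ⟩
    sum ψ ∎

  sum-off-diagonal₂ : ∀ {n} (φ ψ : Fin n → Carrier) →
    ∑[ c < n ] ∑[ d < n ] (ind (c ≁ d) * (φ c * ψ d)) + ∑[ c < n ] (φ c * ψ c) ≈ sum φ * sum ψ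
  sum-off-diagonal₂ {n} φ ψ = begin
    ∑[ c < n ] ∑[ d < n ] (ind (c ≁ d) * (φ c * ψ d)) + ∑[ c < n ] (φ c * ψ c)
      ≈⟨ ∑-distrib-+ {n} _ _ ⟨
    ∑[ c < n ] (∑[ d < n ] (ind (c ≁ d) * (φ c * ψ d)) + φ c * ψ c)
      ≈⟨ sum-cong-≋ (λ c → trans (sum-off-diagonal c (λ d → φ c * ψ d)) (sym (*-distribˡ-sum (φ c) ψ))) ⟩
    ∑[ c < n ] (φ c * sum ψ)
      ≈⟨ *-distribʳ-sum (sum ψ) φ ⟨
    sum φ * sum ψ ∎

-- The transfer operator of an edge.

module Transfer (R : CommutativeRing 0ℓ 0ℓ) {L : ℕ} (x : Fin L → CommutativeRing.Carrier R) where
  open CommutativeRing R hiding (zero)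
  open Indicator R

  total : (Fin L → Carrier) → Carrier
  total F = ∑[ c < L ] (x c * F c)

  ⟨_∣_⟩ : (Fin L → Carrier) → (Fin L → Carrier) → Carrier
  ⟨ F ∣ K ⟩ = ∑[ c < L ] (x c * (F c * K c))

  T : (Fin L → Carrier) → Fin L → Carrier
  T F c = ∑[ d < L ] (ind (c ≁ d) * (x d * F d))

  T^ : ℕ → (Fin L → Carrier) → Fin L → Carrier
  T^ zero    F = F
  T^ (suc n) F = T (T^ n F)

  -- The transfer matrix is a rank-one matrix minus a diagonal one; this is what makes (1 - t T)⁻¹
  -- computable in closed form.
  T-total : ∀ F c → T F c + x c * F c ≈ total F
  T-total F c = sum-off-diagonal c (λ d → x d * F d)

-- The generating function of the elementary symmetric polynomials.

module Elementary (R : CommutativeRing 0ℓ 0ℓ) where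
  open CommutativeRing R hiding (zero)
  open PowerSeries R public
  open RingProperties ring using (-‿distribˡ-*)
  module S = CommutativeRing series
  module SI = Indicator series
  open S using () renaming (_+_ to infixl 6 _⊞_; _*_ to infixl 7 _⊠_)
  open SemiringSolver S.commutativeSemiring using (solve; _:=_; _:+_; _:*_)
  module ≋-Reasoning = SetoidReasoning S.setoid

  -- A colour is deleted by setting its variable to zero, so the index type stays `Fin L` and
  -- deletions can be iterated.
  _∖_ : ∀ {L} → (Fin L → Carrier) → Fin L → Fin L → Carrier
  (x ∖ c) d = if does (d ≟ c) then 0# else x d

  linear : Carrier → Series
  linear a = const 1# ⊞ var ⊠ const a

  linear-⊛ : ∀ a f n → (linear a ⊛ f) n ≈ f n + shift (λ i → a * f i) n
  linear-⊛ a f n = begin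
    (linear a ⊛ f) n
      ≈⟨ ⊛-distribʳ f (const 1#) (var ⊛ const a) n ⟩
    (const 1# ⊛ f) n + ((var ⊛ const a) ⊛ f) n
      ≈⟨ +-cong (⊛-identityˡ f n) (⊛-assoc var (const a) f n) ⟩
    f n + (var ⊛ (const a ⊛ f)) n
      ≈⟨ +-congˡ (trans (⊛-cong {var} (λ _ → refl) (const-⊛ a f) n) (var-⊛ _ n)) ⟩
    f n + shift (λ i → a * f i) n ∎
    where open SetoidReasoning setoid

  -- The geometric series 1 / (1 + a t).
  inv : Carrier → Series
  inv a zero    = 1#
  inv a (suc n) = - a * inv a n

  linear-inv : ∀ a → linear a ⊛ inv a ≋ const 1#
  linear-inv a zero    = trans (linear-⊛ a (inv a) 0) (+-identityʳ _)
  linear-inv a (suc n) = trans (linear-⊛ a (inv a) (suc n))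
    (trans (+-congʳ (sym (-‿distribˡ-* a (inv a n)))) (-‿inverseˡ _))

  const-cong : ∀ {a b} → a ≈ b → const a ≋ const b
  const-cong p zero    = p
  const-cong p (suc n) = refl

  θ-linear : ∀ a → θ (linear a) ≋ var ⊠ const a
  θ-linear a = begin
    θ (linear a)
      ≈⟨ θ-+ (const 1#) (var ⊠ const a) ⟩
    θ (const 1#) ⊞ θ (var ⊠ const a)
      ≈⟨ S.+-cong (θ-const 1#) (θ-⊛ var (const a)) ⟩
    S.0# ⊞ (θ var ⊠ const a ⊞ var ⊠ θ (const a))
      ≈⟨ S.+-identityˡ _ ⟩
    θ var ⊠ const a ⊞ var ⊠ θ (const a)
      ≈⟨ S.+-cong (S.*-congʳ θ-var) (S.trans (S.*-congˡ (θ-const a)) (S.zeroʳ _)) ⟩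
    var ⊠ const a ⊞ S.0#
      ≈⟨ S.+-identityʳ _ ⟩
    var ⊠ const a ∎
    where open ≋-Reasoning

  -- Once `linear a ⊠ inv a`, which is 1, is inserted before `θ I`, the left side is I times the
  -- Leibniz expansion of θ (linear a ⊠ inv a), and θ 1 = 0.
  θ-inv : ∀ a → θ (inv a) ⊞ var ⊠ (const a ⊠ (inv a ⊠ inv a)) ≋ S.0#
  θ-inv a = begin
    θ I ⊞ var ⊠ (const a ⊠ (I ⊠ I))
      ≈⟨ S.+-congʳ (S.trans (S.*-congʳ (linear-inv a)) (S.*-identityˡ _)) ⟨
    linear a ⊠ I ⊠ θ I ⊞ var ⊠ (const a ⊠ (I ⊠ I))
      ≈⟨ solve 5 (λ P I J t c → P :* I :* J :+ t :* (c :* (I :* I)) := I :* (t :* c :* I :+ P :* J)) S.refl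
           (linear a) I (θ I) var (const a) ⟩
    I ⊠ (var ⊠ const a ⊠ I ⊞ linear a ⊠ θ I)
      ≈⟨ S.*-congˡ {I} (S.+-congʳ {linear a ⊠ θ I} (S.*-congʳ {I} (θ-linear a))) ⟨
    I ⊠ (θ (linear a) ⊠ I ⊞ linear a ⊠ θ I)
      ≈⟨ S.*-congˡ {I} (θ-⊛ (linear a) I) ⟨
    I ⊠ θ (linear a ⊠ I)
      ≈⟨ S.*-congˡ {I} (S.trans (θ-cong (linear-inv a)) (θ-const 1#)) ⟩
    I ⊠ S.0#
      ≈⟨ S.zeroʳ I ⟩
    S.0# ∎
    where
    open ≋-Reasoning
    I = inv a

  -- The product of the factors 1 + x_c t; its coefficient of degree n is the n-th elementary
  -- symmetric polynomial.
  elem : ∀ {L} → (Fin L → Carrier) → Series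
  elem {zero}  x = const 1#
  elem {suc L} x = linear (x zero) ⊛ elem (x ∘ suc)

  logDeriv : ∀ {L} → (Fin L → Carrier) → Series
  logDeriv x = SI.sum (λ c → const (x c) ⊛ inv (x c))

  -- Logarithmic differentiation, one factor at a time. Where the head factor is the one
  -- differentiated, it is restored by inserting `P ⊠ I`, which is 1.
  θ-elem : ∀ {L} (x : Fin L → Carrier) → θ (elem x) ≋ var ⊛ (elem x ⊛ logDeriv x)
  θ-elem {zero}  x = S.trans (θ-const 1#) (S.sym (S.trans (S.*-congˡ {var} (S.zeroʳ (const 1#))) (S.zeroʳ var)))
  θ-elem {suc L} x = begin
    θ (P ⊠ E)
      ≈⟨ θ-⊛ P E ⟩
    θ P ⊠ E ⊞ P ⊠ θ E
      ≈⟨ S.+-cong (S.*-congʳ {E} (θ-linear (x zero))) (S.*-congˡ {P} (θ-elem (x ∘ suc))) ⟩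
    var ⊠ X ⊠ E ⊞ P ⊠ (var ⊠ (E ⊠ D))
      ≈⟨ S.+-congʳ {P ⊠ (var ⊠ (E ⊠ D))} (S.trans (S.*-congˡ {var ⊠ X ⊠ E} (linear-inv (x zero))) (S.*-identityʳ (var ⊠ X ⊠ E))) ⟨
    var ⊠ X ⊠ E ⊠ (P ⊠ I) ⊞ P ⊠ (var ⊠ (E ⊠ D))
      ≈⟨ solve 6 (λ t X E P I D → t :* X :* E :* (P :* I) :+ P :* (t :* (E :* D)) := t :* (P :* E :* (X :* I :+ D)))
           S.refl var X E P I D ⟩
    var ⊠ (P ⊠ E ⊠ (X ⊠ I ⊞ D)) ∎
    where
    open ≋-Reasoning
    P = linear (x zero)
    I = inv (x zero)
    X = const (x zero)
    E = elem (x ∘ suc)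
    D = logDeriv (x ∘ suc)

  linear-0 : linear 0# ≋ const 1#
  linear-0 n = trans (+-congˡ (trans (⊛-comm var (const 0#) n) (trans (const-⊛ 0# var n) (zeroˡ _)))) (+-identityʳ _)

  -- Setting the variable of c to zero replaces its factor by `linear 0#`, which is 1; the original
  -- factor then moves to the front of the product.
  elem-∖ : ∀ {L} (x : Fin L → Carrier) c → elem x ≋ linear (x c) ⊛ elem (x ∖ c)
  elem-∖ {suc L} x zero    = ⊛-cong {linear (x zero)} S.refl
    (S.sym (S.trans (S.*-congʳ {elem (x ∘ suc)} linear-0) (⊛-identityˡ _)))
  elem-∖ {suc L} x (suc c) = begin
    linear (x zero) ⊛ elem (x ∘ suc)
      ≈⟨ ⊛-cong {linear (x zero)} S.refl (elem-∖ (x ∘ suc) c) ⟩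
    linear (x zero) ⊛ (linear (x (suc c)) ⊛ elem ((x ∘ suc) ∖ c))
      ≈⟨ solve 3 (λ a b c → a :* (b :* c) := b :* (a :* c)) S.refl (linear (x zero)) (linear (x (suc c))) (elem ((x ∘ suc) ∖ c)) ⟩
    linear (x (suc c)) ⊛ (linear (x zero) ⊛ elem ((x ∘ suc) ∖ c)) ∎
    where open ≋-Reasoning

  elem-∖-inv : ∀ {L} (x : Fin L → Carrier) c → elem (x ∖ c) ≋ inv (x c) ⊛ elem x
  elem-∖-inv x c = begin
    E′                              ≈⟨ S.*-identityˡ E′ ⟨
    const 1# ⊛ E′                   ≈⟨ S.*-congʳ {E′} (linear-inv (x c)) ⟨
    linear (x c) ⊛ I ⊛ E′           ≈⟨ solve 3 (λ a b c → a :* b :* c := b :* (a :* c)) S.refl (linear (x c)) I E′ ⟩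
    I ⊛ (linear (x c) ⊛ E′)         ≈⟨ S.*-congˡ {I} (elem-∖ x c) ⟨
    I ⊛ elem x ∎
    where
    open ≋-Reasoning
    E′ = elem (x ∖ c)
    I = inv (x c)

  ∖-≢ : ∀ {L} (x : Fin L → Carrier) {c d} → c ≢ d → (x ∖ c) d ≡ x d
  ∖-≢ x {c} {d} c≢d with d ≟ c
  ... | yes d≡c with () ← c≢d (≡.sym d≡c)
  ... | no  _   = ≡.refl

  sum-at : ∀ {m} (f : Fin m → Series) n → SI.sum f n ≡ Indicator.sum R (λ c → f c n)
  sum-at {zero}  f n = ≡.refl
  sum-at {suc m} f n = ≡.cong (f zero n +_) (sum-at (f ∘ suc) n)

  θ-sum : ∀ {m} (g : Fin m → Series) → θ (SI.sum g) ≋ SI.sum (θ ∘ g)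
  θ-sum {zero}  g = ×-zeroʳ
  θ-sum {suc m} g = S.trans (θ-+ (g zero) (SI.sum (g ∘ suc))) (S.+-congˡ {θ (g zero)} (θ-sum (g ∘ suc)))

  θ-scale : ∀ a g → θ (const a ⊠ g) ≋ const a ⊠ θ g
  θ-scale a g = S.trans (θ-⊛ (const a) g)
    (S.trans (S.+-congʳ {const a ⊠ θ g} (S.trans (S.*-congʳ {g} (θ-const a)) (S.zeroˡ g))) (S.+-identityˡ _))

-- The generating function identity behind the theorem.

module Identity (R : CommutativeRing 0ℓ 0ℓ) {L : ℕ} (x : Fin L → CommutativeRing.Carrier R) where
  open CommutativeRing R hiding (zero)
  open Transfer R x
  open Elementary R
  open Indicator R
  open SemiringMult semiring using () renaming (_×_ to _·ₙ_)
  open SemiringSolver S.commutativeSemiring using (solve; _:=_; _:+_; _:*_)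
  open S using () renaming (_+_ to infixl 6 _⊞_; _*_ to infixl 7 _⊠_)

  E A : Series
  E = elem x
  A = logDeriv x

  X I : Fin L → Series
  X c = const (x c)
  I c = inv (x c)

  totals : (Fin L → Carrier) → Series
  totals F n = total (T^ n F)

  orbit : (Fin L → Carrier) → Fin L → Series
  orbit F c n = T^ n F c

  weighted : (Fin L → Carrier) → Fin L → Series
  weighted F c = X c ⊠ const (F c) ⊠ I c

  -- Summing T^(n+1) F + x T^n F = total (T^n F) over n: the generating series of the orbit is (1 - t T)⁻¹ F.
  orbit-inv : ∀ F c → orbit F c ≋ I c ⊠ (const (F c) ⊞ var ⊠ totals F)
  orbit-inv F c = begin
    Φ                      ≈⟨ S.*-identityˡ Φ ⟨
    const 1# ⊠ Φ           ≈⟨ S.*-congʳ {Φ} (linear-inv (x c)) ⟨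
    P ⊠ I c ⊠ Φ            ≈⟨ solve 3 (λ a b c → a :* b :* c := b :* (a :* c)) S.refl P (I c) Φ ⟩
    I c ⊠ (P ⊠ Φ)          ≈⟨ S.*-congˡ {I c} unroll ⟩
    I c ⊠ (const (F c) ⊞ var ⊠ totals F) ∎
    where
    open ≋-Reasoning
    Φ = orbit F c
    P = linear (x c)
    unroll : P ⊠ Φ ≋ const (F c) ⊞ var ⊠ totals F
    unroll n = trans (linear-⊛ (x c) Φ n) (trans (step n) (+-congˡ (sym (var-⊛ (totals F) n))))
      where
      step : ∀ n → Φ n + shift (λ i → x c * Φ i) n ≈ const (F c) n + shift (totals F) n
      step zero    = refl
      step (suc n) = trans (T-total (T^ n F) c) (sym (+-identityˡ _))

  totals-sum : ∀ F → totals F ≋ SI.sum (λ c → X c ⊠ orbit F c)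
  totals-sum F n = trans (sum-cong-≋ (λ c → sym (const-⊛ (x c) (orbit F c) n)))
    (reflexive (≡.sym (sum-at (λ c → X c ⊠ orbit F c) n)))

  -- Multiply `orbit-inv` by x_c and sum over c: the first part gives the weighted sum, and
  -- `var ⊠ totals F` factors out of the second, leaving A.
  totals-fixed : ∀ F → totals F ≋ SI.sum (weighted F) ⊞ var ⊠ totals F ⊠ A
  totals-fixed F = begin
    s
      ≈⟨ totals-sum F ⟩
    SI.sum (λ c → X c ⊠ orbit F c)
      ≈⟨ SI.sum-cong-≋ (λ c → S.trans (S.*-congˡ {X c} (orbit-inv F c))
           (solve 5 (λ X I F t s → X :* (I :* (F :+ t :* s)) := X :* F :* I :+ t :* s :* (X :* I)) S.refl
             (X c) (I c) (const (F c)) var s)) ⟩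
    SI.sum (λ c → weighted F c ⊞ var ⊠ s ⊠ (X c ⊠ I c))
      ≈⟨ SI.∑-distrib-+ (weighted F) (λ c → var ⊠ s ⊠ (X c ⊠ I c)) ⟩
    SI.sum (weighted F) ⊞ SI.sum (λ c → var ⊠ s ⊠ (X c ⊠ I c))
      ≈⟨ S.+-congˡ {SI.sum (weighted F)} (SI.*-distribˡ-sum (var ⊠ s) (λ c → X c ⊠ I c)) ⟨
    SI.sum (weighted F) ⊞ var ⊠ s ⊠ A ∎
    where
    open ≋-Reasoning
    s = totals F

  module _ (F K : Fin L → Carrier) where
    f k C B P : Series
    f = SI.sum (weighted F)
    k = SI.sum (weighted K)
    C = SI.sum (λ c → weighted F c ⊠ weighted K c)
    B = SI.sum (λ c → X c ⊠ const (F c) ⊠ const (K c) ⊠ I c)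
    P n = ⟨ T^ n F ∣ K ⟩

    pairing-sum : P ≋ SI.sum (λ c → X c ⊠ (const (K c) ⊠ orbit F c))
    pairing-sum n = trans (sum-cong-≋ (λ c → trans (*-congˡ (trans (*-comm _ _) (sym (const-⊛ (K c) (orbit F c) n))))
                                 (sym (const-⊛ (x c) (const (K c) ⊠ orbit F c) n))))
      (reflexive (≡.sym (sum-at (λ c → X c ⊠ (const (K c) ⊠ orbit F c)) n)))

    -- The same substitution of `orbit-inv` as in `totals-fixed`, now with the additional factor K
    -- c.
    pairing : P ≋ B ⊞ var ⊠ (totals F ⊠ k)
    pairing = begin
      P
        ≈⟨ pairing-sum ⟩
      SI.sum (λ c → X c ⊠ (const (K c) ⊠ orbit F c))
        ≈⟨ SI.sum-cong-≋ (λ c → S.trans (S.*-congˡ {X c} (S.*-congˡ {const (K c)} (orbit-inv F c)))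
             (solve 6 (λ X I F K t s → X :* (K :* (I :* (F :+ t :* s))) := X :* F :* K :* I :+ t :* s :* (X :* K :* I)) S.refl
               (X c) (I c) (const (F c)) (const (K c)) var s)) ⟩
      SI.sum (λ c → X c ⊠ const (F c) ⊠ const (K c) ⊠ I c ⊞ var ⊠ s ⊠ weighted K c)
        ≈⟨ SI.∑-distrib-+ (λ c → X c ⊠ const (F c) ⊠ const (K c) ⊠ I c) (λ c → var ⊠ s ⊠ weighted K c) ⟩
      B ⊞ SI.sum (λ c → var ⊠ s ⊠ weighted K c)
        ≈⟨ S.+-congˡ {B} (SI.*-distribˡ-sum (var ⊠ s) (weighted K)) ⟨
      B ⊞ var ⊠ s ⊠ k
        ≈⟨ S.+-congˡ {B} (S.*-assoc var s k) ⟩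
      B ⊞ var ⊠ (s ⊠ k) ∎
      where
      open ≋-Reasoning
      s = totals F

    -- Only `I c` depends on t in each summand of B, so `θ-inv` settles the sum term by term.
    θB : θ B ⊞ var ⊠ C ≋ S.0#
    θB = begin
      θ B ⊞ var ⊠ C
        ≈⟨ S.+-cong (θ-sum b) (SI.*-distribˡ-sum var (λ c → weighted F c ⊠ weighted K c)) ⟩
      SI.sum (θ ∘ b) ⊞ SI.sum (λ c → var ⊠ (weighted F c ⊠ weighted K c))
        ≈⟨ SI.∑-distrib-+ (θ ∘ b) (λ c → var ⊠ (weighted F c ⊠ weighted K c)) ⟨
      SI.sum (λ c → θ (b c) ⊞ var ⊠ (weighted F c ⊠ weighted K c))
        ≈⟨ SI.sum-cong-≋ pointwise ⟩
      SI.sum {L} (λ c → S.0#)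
        ≈⟨ S.trans (SI.sum-cong-≋ {L} (λ _ → S.sym (S.zeroˡ S.0#))) (S.trans (S.sym (SI.*-distribˡ-sum {L} S.0# (λ _ → S.0#))) (S.zeroˡ _)) ⟩
      S.0# ∎
      where
      open ≋-Reasoning
      b : Fin L → Series
      b c = X c ⊠ const (F c) ⊠ const (K c) ⊠ I c
      pointwise : ∀ c → θ (b c) ⊞ var ⊠ (weighted F c ⊠ weighted K c) ≋ S.0#
      pointwise c = begin
        θ (b c) ⊞ tC
          ≈⟨ S.+-congʳ {tC} (θ-cong (solve 4 (λ X F K I → X :* F :* K :* I := X :* (F :* (K :* I))) S.refl (X c) f′ k′ (I c))) ⟩
        θ (X c ⊠ (f′ ⊠ (k′ ⊠ I c))) ⊞ tC
          ≈⟨ S.+-congʳ {tC} (S.trans (θ-scale (x c) (f′ ⊠ (k′ ⊠ I c)))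
               (S.*-congˡ {X c} (S.trans (θ-scale (F c) (k′ ⊠ I c)) (S.*-congˡ {f′} (θ-scale (K c) (I c)))))) ⟩
        X c ⊠ (f′ ⊠ (k′ ⊠ θ (I c))) ⊞ tC
          ≈⟨ solve 6 (λ X F K I J t → X :* (F :* (K :* J)) :+ t :* (X :* F :* I :* (X :* K :* I))
                        := X :* (F :* K) :* (J :+ t :* (X :* (I :* I)))) S.refl (X c) f′ k′ (I c) (θ (I c)) var ⟩
        X c ⊠ (f′ ⊠ k′) ⊠ (θ (I c) ⊞ var ⊠ (X c ⊠ (I c ⊠ I c)))
          ≈⟨ S.*-congˡ {X c ⊠ (f′ ⊠ k′)} (θ-inv (x c)) ⟩
        X c ⊠ (f′ ⊠ k′) ⊠ S.0#
          ≈⟨ S.zeroʳ (X c ⊠ (f′ ⊠ k′)) ⟩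
        S.0# ∎
        where
        f′ = const (F c)
        k′ = const (K c)
        tC = var ⊠ (weighted F c ⊠ weighted K c)

    -- Coefficient n: the edge xy of the clique joins distinct colours c, d, and the other n clique vertices avoid both.
    Q : Series
    Q n = ∑[ c < L ] ∑[ d < L ] (ind (c ≁ d) * (x c * F c * (x d * K d) * elem ((x ∖ c) ∖ d) n))

    -- Coefficient a of `θ E S.- E` is (a - 1) e_a, which is the source of the factor a - 1 in the
    -- second sum of the theorem.
    W : Series
    W = (θ E S.- E) ⊠ (totals F ⊠ totals K)

    -- Deleting c and then d from E multiplies it by `I c` and `I d`. The indicator removes the
    -- pairs c = d, for which the second deletion would contribute no such factor.
    Q-sum : Q ≋ E ⊠ SI.sum (λ c → SI.sum (λ d → SI.ind (c ≁ d) ⊠ (weighted F c ⊠ weighted K d)))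
    Q-sum = begin
      Q
        ≈⟨ (λ n → trans (sum-cong-≋ (λ c → trans (sum-cong-≋ (λ d → entry c d n)) (reflexive (≡.sym (sum-at (λ d → E ⊠ G c d) n)))))
             (reflexive (≡.sym (sum-at (λ c → SI.sum (λ d → E ⊠ G c d)) n)))) ⟩
      SI.sum (λ c → SI.sum (λ d → E ⊠ G c d))
        ≈⟨ SI.sum-cong-≋ (λ c → SI.*-distribˡ-sum E (G c)) ⟨
      SI.sum (λ c → E ⊠ SI.sum (G c))
        ≈⟨ SI.*-distribˡ-sum E (λ c → SI.sum (G c)) ⟨
      E ⊠ SI.sum (λ c → SI.sum (G c)) ∎
      where
      open ≋-Reasoning
      G : Fin L → Fin L → Series
      G c d = SI.ind (c ≁ d) ⊠ (weighted F c ⊠ weighted K d)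
      entry : ∀ c d n → ind (c ≁ d) * (x c * F c * (x d * K d) * elem ((x ∖ c) ∖ d) n) ≈ (E ⊠ G c d) n
      entry c d n with c ≟ d
      ... | yes _  = trans (zeroˡ _) (sym (S.trans (S.*-congˡ {E} (S.zeroˡ (weighted F c ⊠ weighted K d))) (S.zeroʳ E) n))
      ... | no c≢d = trans (*-identityˡ _) (sym (chain n))
        where
        a = x c * F c * (x d * K d)
        chain : E ⊠ (S.1# ⊠ (weighted F c ⊠ weighted K d)) ≋ λ n → a * elem ((x ∖ c) ∖ d) n
        chain = begin
          E ⊠ (S.1# ⊠ (weighted F c ⊠ weighted K d))
            ≈⟨ S.*-congˡ {E} (S.*-identityˡ (weighted F c ⊠ weighted K d)) ⟩
          E ⊠ (weighted F c ⊠ weighted K d)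
            ≈⟨ solve 7 (λ E X F I Y K J → E :* (X :* F :* I :* (Y :* K :* J)) := X :* (F :* (Y :* (K :* (J :* (I :* E))))))
                 S.refl E (X c) (const (F c)) (I c) (X d) (const (K d)) (I d) ⟩
          X c ⊠ (const (F c) ⊠ (X d ⊠ (const (K d) ⊠ (I d ⊠ (I c ⊠ E)))))
            ≈⟨ S.*-congˡ {X c} (S.*-congˡ {const (F c)} (S.*-congˡ {X d} (S.*-congˡ {const (K d)} deleted))) ⟩
          X c ⊠ (const (F c) ⊠ (X d ⊠ (const (K d) ⊠ E″)))
            ≈⟨ (λ n → trans (const-⊛ (x c) _ n) (*-congˡ (trans (const-⊛ (F c) _ n) (*-congˡ
                 (trans (const-⊛ (x d) _ n) (*-congˡ (const-⊛ (K d) E″ n))))))) ⟩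
          (λ n → x c * (F c * (x d * (K d * E″ n))))
            ≈⟨ (λ n → sym (trans (*-assoc _ _ _) (trans (*-assoc _ _ _) (*-congˡ (*-congˡ (*-assoc _ _ _)))))) ⟩
          (λ n → a * E″ n) ∎
          where
          E″ = elem ((x ∖ c) ∖ d)
          deleted : I d ⊠ (I c ⊠ E) ≋ E″
          deleted = begin
            I d ⊠ (I c ⊠ E)              ≈⟨ S.*-congˡ {I d} (elem-∖-inv x c) ⟨
            -- The deletion of c leaves the variable of d unchanged because c and d differ.
            I d ⊠ elem (x ∖ c)           ≡⟨ ≡.cong (λ z → inv z ⊠ elem (x ∖ c)) (∖-≢ x c≢d) ⟨
            inv ((x ∖ c) d) ⊠ elem (x ∖ c) ≈⟨ elem-∖-inv (x ∖ c) d ⟨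
            E″ ∎

    -- The product f k runs over all pairs of colours; its diagonal is C and the rest is Q.
    Q-pairs : Q ⊞ E ⊠ C ≋ E ⊠ (f ⊠ k)
    Q-pairs = begin
      Q ⊞ E ⊠ C          ≈⟨ S.+-congʳ {E ⊠ C} Q-sum ⟩
      E ⊠ G ⊞ E ⊠ C      ≈⟨ S.distribˡ E G C ⟨
      E ⊠ (G ⊞ C)        ≈⟨ S.*-congˡ {E} (SI.sum-off-diagonal₂ (weighted F) (weighted K)) ⟩
      E ⊠ (f ⊠ k) ∎
      where
      open ≋-Reasoning
      G = SI.sum (λ c → SI.sum (λ d → SI.ind (c ≁ d) ⊠ (weighted F c ⊠ weighted K d)))

    u : Series
    u = totals F ⊠ k

    -- By `totals-fixed K`, E u + y equals E times both totals, which cancels the - E in W. What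
    -- remains is θ E times both totals, and this is y by `θ-elem`; hence W + E u + y = y.
    W-cancel : W ⊞ E ⊠ u ≋ S.0#
    W-cancel = GroupProperties.identityˡ-unique S.+-group (W ⊞ E ⊠ u) y (begin
      W ⊞ E ⊠ (s ⊠ k) ⊞ var ⊠ (E ⊠ A) ⊠ (s ⊠ r)
        ≈⟨ solve 7 (λ W E s k t A r → W :+ E :* (s :* k) :+ t :* (E :* A) :* (s :* r) := W :+ E :* (s :* (k :+ t :* r :* A)))
             S.refl W E s k var A r ⟩
      W ⊞ E ⊠ (s ⊠ (k ⊞ var ⊠ r ⊠ A))
        ≈⟨ S.+-congˡ {W} (S.*-congˡ {E} (S.*-congˡ {s} (totals-fixed K))) ⟨
      (θ E S.- E) ⊠ (s ⊠ r) ⊞ E ⊠ (s ⊠ r)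
        ≈⟨ S.distribʳ (s ⊠ r) (θ E S.- E) E ⟨
      (θ E S.- E ⊞ E) ⊠ (s ⊠ r)
        ≈⟨ S.*-congʳ {s ⊠ r} (S.trans (S.+-assoc (θ E) (S.- E) E)
             (S.trans (S.+-congˡ {θ E} (S.-‿inverseˡ E)) (S.+-identityʳ (θ E)))) ⟩
      θ E ⊠ (s ⊠ r)
        ≈⟨ S.*-congʳ {s ⊠ r} (θ-elem x) ⟩
      var ⊠ (E ⊠ A) ⊠ (s ⊠ r) ∎)
      where
      open ≋-Reasoning
      s = totals F
      r = totals K
      y = var ⊠ (E ⊠ A) ⊠ (s ⊠ r)

    -- Z is added to both sides to absorb every negative term: t E C completes Q to all pairs of
    -- colours and cancels against θ B, while t θ (E u) cancels t θ W. Both sides then equal E θ (t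
    -- u).
    identity : var ⊠ Q ≋ E ⊠ θ P ⊞ var ⊠ θ W
    identity = GroupProperties.∙-cancelʳ S.+-group Z (var ⊠ Q) (E ⊠ θ P ⊞ var ⊠ θ W) (S.trans left (S.sym right))
      where
      open ≋-Reasoning
      s = totals F
      Z = var ⊠ (E ⊠ C) ⊞ var ⊠ θ (E ⊠ u)
      left : var ⊠ Q ⊞ Z ≋ E ⊠ (var ⊠ u ⊞ var ⊠ θ u)
      left = begin
        var ⊠ Q ⊞ (var ⊠ (E ⊠ C) ⊞ var ⊠ θ (E ⊠ u))
          ≈⟨ solve 4 (λ t q c z → t :* q :+ (t :* c :+ t :* z) := t :* (q :+ c) :+ t :* z) S.refl var Q (E ⊠ C) (θ (E ⊠ u)) ⟩
        var ⊠ (Q ⊞ E ⊠ C) ⊞ var ⊠ θ (E ⊠ u)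
          ≈⟨ S.+-cong (S.*-congˡ {var} Q-pairs) (S.*-congˡ {var} (S.trans (θ-⊛ E u) (S.+-congʳ {E ⊠ θ u} (S.*-congʳ {u} (θ-elem x))))) ⟩
        var ⊠ (E ⊠ (f ⊠ k)) ⊞ var ⊠ (var ⊠ (E ⊠ A) ⊠ (s ⊠ k) ⊞ E ⊠ θ u)
          -- The derivative of E supplies the term t s A that completes f to s.
          ≈⟨ solve 7 (λ t E f k A s v → t :* (E :* (f :* k)) :+ t :* (t :* (E :* A) :* (s :* k) :+ E :* v)
                        := E :* (t :* ((f :+ t :* s :* A) :* k) :+ t :* v)) S.refl var E f k A s (θ u) ⟩
        E ⊠ (var ⊠ ((f ⊞ var ⊠ s ⊠ A) ⊠ k) ⊞ var ⊠ θ u)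
          ≈⟨ S.*-congˡ {E} (S.+-congʳ {var ⊠ θ u} (S.*-congˡ {var} (S.*-congʳ {k} (totals-fixed F)))) ⟨
        E ⊠ (var ⊠ u ⊞ var ⊠ θ u) ∎
      right : E ⊠ θ P ⊞ var ⊠ θ W ⊞ Z ≋ E ⊠ (var ⊠ u ⊞ var ⊠ θ u)
      right = begin
        E ⊠ θ P ⊞ var ⊠ θ W ⊞ (var ⊠ (E ⊠ C) ⊞ var ⊠ θ (E ⊠ u))
          ≈⟨ S.+-congʳ {Z} (S.+-congʳ {var ⊠ θ W} (S.*-congˡ {E} (S.trans (θ-cong pairing) (θ-+ B (var ⊠ u))))) ⟩
        E ⊠ (θ B ⊞ θ (var ⊠ u)) ⊞ var ⊠ θ W ⊞ (var ⊠ (E ⊠ C) ⊞ var ⊠ θ (E ⊠ u))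
          ≈⟨ solve 7 (λ E b v t w C z → E :* (b :+ v) :+ t :* w :+ (t :* (E :* C) :+ t :* z) := E :* (b :+ t :* C :+ v) :+ t :* (w :+ z))
               S.refl E (θ B) (θ (var ⊠ u)) var (θ W) C (θ (E ⊠ u)) ⟩
        E ⊠ (θ B ⊞ var ⊠ C ⊞ θ (var ⊠ u)) ⊞ var ⊠ (θ W ⊞ θ (E ⊠ u))
          ≈⟨ S.+-cong (S.*-congˡ {E} (S.trans (S.+-congʳ {θ (var ⊠ u)} θB) (S.+-identityˡ (θ (var ⊠ u)))))
               (S.trans (S.*-congˡ {var} (S.trans (S.sym (θ-+ W (E ⊠ u))) (S.trans (θ-cong W-cancel) ×-zeroʳ))) (S.zeroʳ var)) ⟩
        E ⊠ θ (var ⊠ u) ⊞ S.0#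
          ≈⟨ S.+-identityʳ (E ⊠ θ (var ⊠ u)) ⟩
        E ⊠ θ (var ⊠ u)
          ≈⟨ S.*-congˡ {E} (S.trans (θ-⊛ var u) (S.+-congʳ {var ⊠ θ u} (S.*-congʳ {u} θ-var))) ⟩
        E ⊠ (var ⊠ u ⊞ var ⊠ θ u) ∎

    -- The factor t moves Q n to degree `suc n`, and θ contributes the multiplier n, which is the m
    -- - 2 before the second sum.
    Q-coefficient : ∀ n → Q n ≈ (E ⊛ θ P) (suc n) + n ·ₙ W n
    Q-coefficient n = trans (sym (var-⊛ Q (suc n)))
      (trans (identity (suc n)) (+-congˡ (var-⊛ (θ W) (suc n))))

-- Colourings of glued graphs

private variable
  A B : Set

allᵇ-++ : (p : A → Bool) (xs ys : List A) → allᵇ p (xs ++ ys) ≡ allᵇ p xs ∧ allᵇ p ys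
allᵇ-++ p []       ys = ≡.refl
allᵇ-++ p (x ∷ xs) ys = ≡.trans (≡.cong (p x ∧_) (allᵇ-++ p xs ys)) (≡.sym (∧-assoc (p x) _ _))

allᵇ-cong : {p q : A → Bool} → (∀ x → p x ≡ q x) → ∀ xs → allᵇ p xs ≡ allᵇ q xs
allᵇ-cong p≗q []       = ≡.refl
allᵇ-cong p≗q (x ∷ xs) = ≡.cong₂ _∧_ (p≗q x) (allᵇ-cong p≗q xs)

allᵇ-map : (p : B → Bool) (f : A → B) (xs : List A) → allᵇ p (map f xs) ≡ allᵇ (p ∘ f) xs
allᵇ-map p f []       = ≡.refl
allᵇ-map p f (x ∷ xs) = ≡.cong (p (f x) ∧_) (allᵇ-map p f xs)

allᵇ-filterᵇ : (p q : A → Bool) (xs : List A) → allᵇ p (filterᵇ q xs) ≡ allᵇ (λ x → not (q x) ∨ p x) xs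
allᵇ-filterᵇ p q []       = ≡.refl
allᵇ-filterᵇ p q (x ∷ xs) with q x
... | true  = ≡.cong (p x ∧_) (allᵇ-filterᵇ p q xs)
... | false = allᵇ-filterᵇ p q xs

allᵇ-cartesianProduct : (p : A × B → Bool) (xs : List A) (ys : List B) →
  allᵇ p (cartesianProduct xs ys) ≡ allᵇ (λ x → allᵇ (λ y → p (x , y)) ys) xs
allᵇ-cartesianProduct p []       ys = ≡.refl
allᵇ-cartesianProduct p (x ∷ xs) ys = ≡.trans (allᵇ-++ p (map (x ,_) ys) _)
  (≡.cong₂ _∧_ (allᵇ-map p (x ,_) ys) (allᵇ-cartesianProduct p xs ys))

allᵇ-allFin-suc : ∀ {n} (p : Fin (suc n) → Bool) →
  allᵇ p (allFin (suc n)) ≡ p zero ∧ allᵇ (p ∘ suc) (allFin n)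
allᵇ-allFin-suc {n} p = ≡.cong (p zero ∧_)
  (≡.trans (≡.cong (allᵇ p) (≡.sym (map-tabulate (λ i → i) suc))) (allᵇ-map p suc (allFin n)))

≁-sym : ∀ {n} (c d : Fin n) → (c ≁ d) ≡ (d ≁ c)
≁-sym zero    zero    = ≡.refl
≁-sym zero    (suc d) = ≡.refl
≁-sym (suc c) zero    = ≡.refl
≁-sym (suc c) (suc d) = ≁-sym c d

avoids : ∀ {L n} → Fin L → Vec (Fin L) n → Bool
avoids c []      = true
avoids c (d ∷ κ) = (c ≁ d) ∧ avoids c κ

distinct : ∀ {L n} → Vec (Fin L) n → Bool
distinct []      = true
distinct (c ∷ κ) = avoids c κ ∧ distinct κ

open CommutativeMonoidSolver ∧-commutativeMonoid using () renaming (solve to ∧-solve; _⊕_ to _:∧_; _⊜_ to _:≡_)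

avoids-insertAt : ∀ {L n} (c : Fin L) (κ : Vec (Fin L) n) i d →
  avoids c (insertAt κ i d) ≡ (c ≁ d) ∧ avoids c κ
avoids-insertAt c κ       zero    d = ≡.refl
avoids-insertAt c (a ∷ κ) (suc i) d = ≡.trans (≡.cong ((c ≁ a) ∧_) (avoids-insertAt c κ i d))
  (∧-solve 3 (λ p q r → p :∧ (q :∧ r) :≡ q :∧ (p :∧ r)) ≡.refl (c ≁ a) (c ≁ d) (avoids c κ))

-- Insertion at an arbitrary position is needed because the two chosen vertices of the clique are
-- arbitrary.
distinct-insertAt : ∀ {L n} (κ : Vec (Fin L) n) i c →
  distinct (insertAt κ i c) ≡ avoids c κ ∧ distinct κ
distinct-insertAt κ       zero    c = ≡.refl
distinct-insertAt (a ∷ κ) (suc i) c = ≡.trans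
  (≡.cong₂ _∧_ (≡.trans (avoids-insertAt a κ i c) (≡.cong (_∧ avoids a κ) (≁-sym a c))) (distinct-insertAt κ i c))
  (∧-solve 4 (λ p q r s → (p :∧ q) :∧ (r :∧ s) :≡ (p :∧ r) :∧ (q :∧ s)) ≡.refl
    (c ≁ a) (avoids a κ) (avoids c κ) (distinct κ))

avoids-lookup : ∀ {L n} (c : Fin L) (κ : Vec (Fin L) n) → allᵇ (λ j → c ≁ lookup κ j) (allFin n) ≡ avoids c κ
avoids-lookup c []      = ≡.refl
avoids-lookup c (d ∷ κ) = ≡.trans (allᵇ-allFin-suc (λ j → c ≁ lookup (d ∷ κ) j)) (≡.cong ((c ≁ d) ∧_) (avoids-lookup c κ))

-- Filtering by i < j becomes the implication `ok`. It holds vacuously when the second index is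
-- zero; the row of the first vertex is `avoids`, and the remaining square is the same problem for
-- the tail.
proper-Complete : ∀ {L n} (κ : Vec (Fin L) n) → proper (Complete n) κ ≡ distinct κ
proper-Complete {L} {n} κ = ≡.trans (allᵇ-filterᵇ _ _ (cartesianProduct (allFin n) (allFin n)))
  (≡.trans (allᵇ-cartesianProduct _ (allFin n) (allFin n)) (go κ))
  where
  ok : ∀ {n} → Vec (Fin L) n → Fin n → Fin n → Bool
  ok κ i j = not (suc (toℕ i) ≤ᵇ toℕ j) ∨ (lookup κ i ≁ lookup κ j)
  go : ∀ {n} (κ : Vec (Fin L) n) → allᵇ (λ i → allᵇ (ok κ i) (allFin n)) (allFin n) ≡ distinct κ
  go []              = ≡.refl
  go {suc n} (c ∷ κ) = ≡.trans (allᵇ-allFin-suc {n} (λ i → allᵇ (ok (c ∷ κ) i) (allFin (suc n)))) (≡.cong₂ _∧_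
    (≡.trans (allᵇ-allFin-suc (ok (c ∷ κ) zero)) (avoids-lookup c κ))
    (≡.trans (allᵇ-cong (λ i → allᵇ-allFin-suc (ok (c ∷ κ) (suc i))) (allFin n)) (go κ)))

proper-Path : ∀ {L k} (c d : Fin L) (κ : Vec (Fin L) k) →
  proper (Path (suc k)) (c ∷ d ∷ κ) ≡ (c ≁ d) ∧ proper (Path k) (d ∷ κ)
proper-Path {k = k} c d κ = ≡.cong ((c ≁ d) ∧_) (begin
  allᵇ ok (map step (tabulate suc))               ≡⟨ ≡.cong (λ es → allᵇ ok (map step es)) (map-tabulate (λ i → i) suc) ⟨
  allᵇ ok (map step (map suc (allFin k)))         ≡⟨ allᵇ-map ok step (map suc (allFin k)) ⟩
  allᵇ (ok ∘ step) (map suc (allFin k))           ≡⟨ allᵇ-map (ok ∘ step) suc (allFin k) ⟩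
  allᵇ (ok ∘ step ∘ suc) (allFin k)               ≡⟨ allᵇ-map _ _ (allFin k) ⟨
  proper (Path k) (d ∷ κ) ∎)
  where
  open ≡.≡-Reasoning
  ok : Fin (suc (suc k)) × Fin (suc (suc k)) → Bool
  ok e = lookup (c ∷ d ∷ κ) (proj₁ e) ≁ lookup (c ∷ d ∷ κ) (proj₂ e)
  step : ∀ {n} → Fin n → Fin (suc n) × Fin (suc n)
  step i = inject₁ i , suc i

-- A colouring of a glued graph is a concatenation. The identified vertex takes its colour from κ,
-- and any other vertex of H sits in κ′ at its index with s punched out, which inserting at s
-- undoes.
lookup-embR : ∀ {L a b} (κ : Vec (Fin L) a) (κ′ : Vec (Fin L) b) r s w →
  lookup (κ Vec.++ κ′) (embR r s w) ≡ lookup (insertAt κ′ s (lookup κ r)) w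
lookup-embR κ κ′ r s w with w ≟ s
... | yes ≡.refl = ≡.trans (lookup-++ˡ κ κ′ r) (≡.sym (insertAt-lookup κ′ s (lookup κ r)))
... | no  w≢s    = ≡.trans (lookup-++ʳ κ κ′ _) (≡.trans
  (≡.sym (insertAt-punchIn κ′ s (lookup κ r) _)) (≡.cong (lookup (insertAt κ′ s (lookup κ r))) (punchIn-punchOut {i = s} {j = w} _)))

proper-glue : ∀ {L a b} (G : Graph a) r (H : Graph (suc b)) s (κ : Vec (Fin L) a) (κ′ : Vec (Fin L) b) →
  proper (glue G r H s) (κ Vec.++ κ′) ≡ proper G κ ∧ proper H (insertAt κ′ s (lookup κ r))
proper-glue {b = b} G r H s κ κ′ = ≡.trans (allᵇ-++ ok (map _ G) (map _ H)) (≡.cong₂ _∧_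
  (≡.trans (allᵇ-map ok _ G) (allᵇ-cong (λ e → ≡.cong₂ _≁_ (lookup-++ˡ κ κ′ (proj₁ e)) (lookup-++ˡ κ κ′ (proj₂ e))) G))
  (≡.trans (allᵇ-map ok _ H) (allᵇ-cong (λ e → ≡.cong₂ _≁_ (lookup-embR κ κ′ r s (proj₁ e)) (lookup-embR κ κ′ r s (proj₂ e))) H)))
  where
  ok : Fin _ × Fin _ → Bool
  ok e = lookup (κ Vec.++ κ′) (proj₁ e) ≁ lookup (κ Vec.++ κ′) (proj₂ e)

-- Weighted sums over colourings, gluing and paths.

module Colourings (R : CommutativeRing 0ℓ 0ℓ) {L : ℕ} where
  open CommutativeRing R hiding (zero)
  open Indicator R
  open SemiringSolver commutativeSemiring using (solve; _:=_; _:*_)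
  open SetoidReasoning setoid

  sumVec : ∀ {n} → (Vec (Fin L) n → Carrier) → Carrier
  sumVec {zero}  φ = φ []
  sumVec {suc n} φ = ∑[ c < L ] sumVec (φ ∘ (c ∷_))

  sumVec-cong : ∀ {n} {φ ψ : Vec (Fin L) n → Carrier} → (∀ κ → φ κ ≈ ψ κ) → sumVec φ ≈ sumVec ψ
  sumVec-cong {zero}  p = p []
  sumVec-cong {suc n} p = sum-cong-≋ (λ c → sumVec-cong (p ∘ (c ∷_)))

  *-distribˡ-sumVec : ∀ {n} a (φ : Vec (Fin L) n → Carrier) → a * sumVec φ ≈ sumVec (λ κ → a * φ κ)
  *-distribˡ-sumVec {zero}  a φ = refl
  *-distribˡ-sumVec {suc n} a φ = trans (*-distribˡ-sum {L} a _)
    (sum-cong-≋ (λ c → *-distribˡ-sumVec a (φ ∘ (c ∷_))))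

  sumVec-++ : ∀ {m n} (φ : Vec (Fin L) (m ℕ.+ n) → Carrier) →
    sumVec φ ≈ sumVec {m} (λ κ → sumVec {n} (λ κ′ → φ (κ Vec.++ κ′)))
  sumVec-++ {zero}  φ = refl
  sumVec-++ {suc m} φ = sum-cong-≋ (λ c → sumVec-++ {m} (φ ∘ (c ∷_)))

  -- The sum over the colour of position i is moved outermost by exchanging finite sums.
  sumVec-insertAt : ∀ {n} i (φ : Vec (Fin L) (suc n) → Carrier) →
    sumVec φ ≈ ∑[ c < L ] sumVec (λ κ → φ (insertAt κ i c))
  sumVec-insertAt {n}     zero    φ = refl
  sumVec-insertAt {suc n} (suc i) φ = trans
    (sum-cong-≋ (λ d → sumVec-insertAt i (φ ∘ (d ∷_)))) (∑-comm {L} {L} (λ d c → sumVec (λ κ → φ (d ∷ insertAt κ i c))))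

  module _ (x : Fin L → Carrier) where
    weight : ∀ {n} → Vec (Fin L) n → Carrier
    weight []      = 1#
    weight (c ∷ κ) = x c * weight κ

    weight-++ : ∀ {m n} (κ : Vec (Fin L) m) (κ′ : Vec (Fin L) n) →
      weight (κ Vec.++ κ′) ≈ weight κ * weight κ′
    weight-++ []      κ′ = sym (*-identityˡ _)
    weight-++ (c ∷ κ) κ′ = trans (*-congˡ (weight-++ κ κ′)) (sym (*-assoc _ _ _))

    weight-insertAt : ∀ {n} (κ : Vec (Fin L) n) i c → weight (insertAt κ i c) ≈ x c * weight κ
    weight-insertAt κ       zero    c = refl
    weight-insertAt (d ∷ κ) (suc i) c = trans (*-congˡ (weight-insertAt κ i c))
      (solve 3 (λ a b c → a :* (b :* c) := b :* (a :* c)) refl (x d) (x c) (weight κ))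

  module _ (x : Fin L → Carrier) where
    open Transfer R x

    -- F is a boundary weight: it stands for whatever is attached to G at r, as a function of the
    -- colour of r.
    chromaticAt : ∀ {n} → Graph n → Fin n → (Fin L → Carrier) → Carrier
    chromaticAt G r F = sumVec (λ κ → ind (proper G κ) * (weight x κ * F (lookup κ r)))

    -- The vertex s is coloured c and its factor x c is left out of the weight.
    rootedAt : ∀ {n} → Graph (suc n) → Fin (suc n) → Fin (suc n) → (Fin L → Carrier) → Fin L → Carrier
    rootedAt G s w F c = sumVec (λ κ → ind (proper G (insertAt κ s c)) * (weight x κ * F (lookup (insertAt κ s c) w)))

    rooted : ∀ {n} → Graph (suc n) → Fin (suc n) → Fin L → Carrier
    rooted G s = rootedAt G s s (λ _ → 1#)

    chromaticAt-cong : ∀ {n} (G : Graph n) r {F F′ : Fin L → Carrier} → (∀ c → F c ≈ F′ c) →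
      chromaticAt G r F ≈ chromaticAt G r F′
    chromaticAt-cong G r p = sumVec-cong (λ κ → *-congˡ (*-congˡ (p (lookup κ r))))

    chromaticAt-rooted : ∀ {n} (G : Graph (suc n)) r F → chromaticAt G r F ≈ ⟨ rooted G r ∣ F ⟩
    chromaticAt-rooted {n} G r F = trans (sumVec-insertAt r (λ κ → ind (proper G κ) * (weight x κ * F (lookup κ r)))) (sum-cong-≋ (λ c → begin
      sumVec (λ κ → p c κ * (weight x (insertAt κ r c) * F (lookup (insertAt κ r c) r)))
        ≈⟨ sumVec-cong (λ κ → trans (*-congˡ (*-cong (weight-insertAt x κ r c) (reflexive (≡.cong F (insertAt-lookup κ r c)))))
             (solve 4 (λ p x w F → p :* (x :* w :* F) := x :* F :* (p :* w)) refl (p c κ) (x c) (weight x κ) (F c))) ⟩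
      sumVec (λ κ → x c * F c * (p c κ * weight x κ))
        ≈⟨ *-distribˡ-sumVec (x c * F c) (λ κ → p c κ * weight x κ) ⟨
      x c * F c * sumVec (λ κ → p c κ * weight x κ)
        ≈⟨ *-congˡ (sumVec-cong {n} (λ κ → *-congˡ (*-identityʳ _))) ⟨
      x c * F c * rooted G r c
        ≈⟨ solve 3 (λ x F g → x :* F :* g := x :* (g :* F)) refl (x c) (F c) (rooted G r c) ⟩
      x c * (rooted G r c * F c) ∎))
      where
      p : Fin L → Vec (Fin L) n → Carrier
      p c κ = ind (proper G (insertAt κ r c))

    -- With the colours on G fixed, the sum over the remaining vertices of H depends only on the
    -- colour of r, so it becomes a boundary weight there. The marked vertex w lets a further graph
    -- be attached inside H.
    chromaticAt-glue : ∀ {a b} (G : Graph a) r (H : Graph (suc b)) s w F →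
      chromaticAt (glue G r H s) (embR r s w) F ≈ chromaticAt G r (rootedAt H s w F)
    chromaticAt-glue {a} {b} G r H s w F = trans (sumVec-++ {a} {b} _) (sumVec-cong (λ κ → begin
      sumVec (λ κ′ → ind (proper (glue G r H s) (κ Vec.++ κ′)) * (weight x (κ Vec.++ κ′) * F (lookup (κ Vec.++ κ′) (embR r s w))))
        ≈⟨ sumVec-cong (λ κ′ → *-cong
             (trans (reflexive (≡.cong ind (proper-glue G r H s κ κ′))) (ind-∧ (proper G κ) (proper H (insertAt κ′ s (lookup κ r)))))
             (*-cong (weight-++ x κ κ′) (reflexive (≡.cong F (lookup-embR κ κ′ r s w))))) ⟩
      sumVec (λ κ′ → ind (proper G κ) * q κ κ′ * (weight x κ * weight x κ′ * F (lookup (insertAt κ′ s (lookup κ r)) w)))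
        ≈⟨ sumVec-cong (λ κ′ → solve 5 (λ p q w v F → p :* q :* (w :* v :* F) := p :* w :* (q :* (v :* F))) refl
             (ind (proper G κ)) (q κ κ′) (weight x κ) (weight x κ′) (F (lookup (insertAt κ′ s (lookup κ r)) w))) ⟩
      sumVec (λ κ′ → ind (proper G κ) * weight x κ * (q κ κ′ * (weight x κ′ * F (lookup (insertAt κ′ s (lookup κ r)) w))))
        ≈⟨ *-distribˡ-sumVec {b} (ind (proper G κ) * weight x κ) _ ⟨
      ind (proper G κ) * weight x κ * rootedAt H s w F (lookup κ r)
        ≈⟨ *-assoc _ _ _ ⟩
      ind (proper G κ) * (weight x κ * rootedAt H s w F (lookup κ r)) ∎))
      where
      q : Vec (Fin L) a → Vec (Fin L) b → Carrier
      q κ κ′ = ind (proper H (insertAt κ′ s (lookup κ r)))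

    -- The second vertex of the path, coloured d, contributes the indicator c ≠ d and the factor
    -- x_d, which is one application of T.
    rootedAt-Path : ∀ k F c → rootedAt (Path k) zero (fromℕ k) F c ≈ T^ k F c
    rootedAt-Path zero    F c = trans (*-identityˡ _) (*-identityˡ _)
    rootedAt-Path (suc k) F c = sum-cong-≋ (λ d → begin
      sumVec (λ κ → ind (proper (Path (suc k)) (c ∷ d ∷ κ)) * (x d * weight x κ * F (lookup (d ∷ κ) (fromℕ k))))
        ≈⟨ sumVec-cong (λ κ → trans (*-congʳ (trans (reflexive (≡.cong ind (proper-Path c d κ))) (ind-∧ (c ≁ d) (proper (Path k) (d ∷ κ)))))
             (solve 5 (λ i p x w F → i :* p :* (x :* w :* F) := i :* x :* (p :* (w :* F))) refl
               (ind (c ≁ d)) (ind (proper (Path k) (d ∷ κ))) (x d) (weight x κ) (F (lookup (d ∷ κ) (fromℕ k))))) ⟩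
      sumVec (λ κ → ind (c ≁ d) * x d * (ind (proper (Path k) (d ∷ κ)) * (weight x κ * F (lookup (d ∷ κ) (fromℕ k)))))
        ≈⟨ *-distribˡ-sumVec {k} (ind (c ≁ d) * x d) _ ⟨
      ind (c ≁ d) * x d * rootedAt (Path k) zero (fromℕ k) F d
        ≈⟨ trans (*-assoc _ _ _) (*-congˡ (*-congˡ (rootedAt-Path k F d))) ⟩
      ind (c ≁ d) * (x d * T^ k F d) ∎)

    chromaticAt-Pk : ∀ {a b} (G : Graph (suc a)) u (H : Graph (suc b)) v k w F →
      chromaticAt (Pk G u H v k) (PkEmbR u v k w) F ≈ chromaticAt G u (T^ k (rootedAt H v w F))
    chromaticAt-Pk G u H v k w F = trans (chromaticAt-glue (glue G u (Path k) zero) (embR u zero (fromℕ k)) H v w F)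
      (trans (chromaticAt-glue G u (Path k) zero (fromℕ k) (rootedAt H v w F))
        (chromaticAt-cong G u (rootedAt-Path k (rootedAt H v w F))))

    T-cong : ∀ {F F′ : Fin L → Carrier} → (∀ c → F c ≈ F′ c) → ∀ c → T F c ≈ T F′ c
    T-cong p c = sum-cong-≋ (λ d → *-congˡ (*-congˡ (p d)))

    T^-cong : ∀ n {F F′ : Fin L → Carrier} → (∀ c → F c ≈ F′ c) → ∀ c → T^ n F c ≈ T^ n F′ c
    T^-cong zero    p = p
    T^-cong (suc n) p = T-cong (T^-cong n p)

    ⟨∣⟩-cong : ∀ {F F′ K K′ : Fin L → Carrier} → (∀ c → F c ≈ F′ c) → (∀ c → K c ≈ K′ c) → ⟨ F ∣ K ⟩ ≈ ⟨ F′ ∣ K′ ⟩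
    ⟨∣⟩-cong p q = sum-cong-≋ (λ c → *-congˡ (*-cong (p c) (q c)))

    -- Being different is a symmetric relation on colours, so T is self-adjoint for the pairing
    -- weighted by x.
    T-adjoint : ∀ F K → ⟨ F ∣ T K ⟩ ≈ ⟨ T F ∣ K ⟩
    T-adjoint F K = begin
      ∑[ c < L ] (x c * (F c * T K c))
        ≈⟨ sum-cong-≋ (λ c → trans (sym (*-assoc _ _ _)) (*-distribˡ-sum {L} (x c * F c) _)) ⟩
      ∑[ c < L ] ∑[ d < L ] (x c * F c * (ind (c ≁ d) * (x d * K d)))
        ≈⟨ ∑-comm {L} {L} _ ⟩
      ∑[ d < L ] ∑[ c < L ] (x c * F c * (ind (c ≁ d) * (x d * K d)))
        ≈⟨ sum-cong-≋ {L} (λ d → sum-cong-≋ {L} (λ c → trans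
             (*-congˡ (*-congʳ (reflexive (≡.cong ind (≁-sym c d)))))
             (solve 5 (λ x F i y K → x :* F :* (i :* (y :* K)) := y :* K :* (i :* (x :* F))) refl (x c) (F c) (ind (d ≁ c)) (x d) (K d)))) ⟩
      ∑[ d < L ] ∑[ c < L ] (x d * K d * (ind (d ≁ c) * (x c * F c)))
        ≈⟨ sum-cong-≋ (λ d → trans (sym (*-distribˡ-sum {L} (x d * K d) _)) (trans (*-assoc _ _ _) (*-congˡ (*-comm _ _)))) ⟩
      ∑[ d < L ] (x d * (T F d * K d)) ∎

    T^-+ : ∀ m n F c → T^ (m ℕ.+ n) F c ≈ T^ m (T^ n F) c
    T^-+ zero    n F c = refl
    T^-+ (suc m) n F c = T-cong (T^-+ m n F) c

    T^-adjoint : ∀ n F K → ⟨ F ∣ T^ n K ⟩ ≈ ⟨ T^ n F ∣ K ⟩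
    T^-adjoint zero    F K = refl
    T^-adjoint (suc n) F K = begin
      ⟨ F ∣ T (T^ n K) ⟩  ≈⟨ T-adjoint F (T^ n K) ⟩
      ⟨ T F ∣ T^ n K ⟩    ≈⟨ T^-adjoint n (T F) K ⟩
      -- The induction hypothesis leaves the extra T innermost, whereas `T^ (suc n)` has it
      -- outermost.
      ⟨ T^ n (T F) ∣ K ⟩  ≈⟨ ⟨∣⟩-cong (λ c → T^-+ n 1 F c) (λ _ → refl) ⟨
      ⟨ T^ (n ℕ.+ 1) F ∣ K ⟩ ≡⟨ ≡.cong (λ m → ⟨ T^ m F ∣ K ⟩) (ℕₚ.+-comm n 1) ⟩
      ⟨ T^ (suc n) F ∣ K ⟩ ∎

-- The contribution of a clique.

module Clique (R : CommutativeRing 0ℓ 0ℓ) {L : ℕ} where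
  open CommutativeRing R hiding (zero)
  open Indicator R
  open Elementary R
  open Colourings R {L}
  open SemiringMult semiring using (×-congʳ; ×-comm-*; ×-assocˡ) renaming (_×_ to _·ₙ_)
  open SemiringSolver commutativeSemiring using (solve; _:=_; _:*_)
  open SetoidReasoning setoid

  -- The left side is a coefficient of E A, and t E A = θ E. Combinatorially, each monomial of
  -- degree n + 1 arises once from each of its n + 1 variables.
  sum-elem-∖ : ∀ (x : Fin L → Carrier) n → ∑[ c < L ] (x c * elem (x ∖ c) n) ≈ suc n ·ₙ elem x (suc n)
  sum-elem-∖ x n = begin
    ∑[ c < L ] (x c * elem (x ∖ c) n)
      ≈⟨ sum-cong-≋ (λ c → trans (S.trans
           (S.trans (⊛-comm (elem x) (const (x c) ⊛ inv (x c))) (⊛-assoc (const (x c)) (inv (x c)) (elem x)))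
           (S.*-congˡ {const (x c)} (S.sym (elem-∖-inv x c)))
           n) (const-⊛ (x c) (elem (x ∖ c)) n)) ⟨
    ∑[ c < L ] ((elem x ⊛ (const (x c) ⊛ inv (x c))) n)
      ≡⟨ sum-at (λ c → elem x ⊛ (const (x c) ⊛ inv (x c))) n ⟨
    SI.sum (λ c → elem x ⊛ (const (x c) ⊛ inv (x c))) n
      ≈⟨ SI.*-distribˡ-sum (elem x) (λ c → const (x c) ⊛ inv (x c)) n ⟨
    (elem x ⊛ logDeriv x) n
      ≈⟨ var-⊛ (elem x ⊛ logDeriv x) (suc n) ⟨
    (var ⊛ (elem x ⊛ logDeriv x)) (suc n)
      ≈⟨ θ-elem x (suc n) ⟨
    suc n ·ₙ elem x (suc n) ∎

  -- A zero variable annihilates exactly the colourings that use its colour.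
  weight-∖ : ∀ {n} (x : Fin L → Carrier) c (κ : Vec (Fin L) n) →
    ind (avoids c κ) * weight x κ ≈ weight (x ∖ c) κ
  weight-∖ x c []      = *-identityˡ _
  weight-∖ x c (d ∷ κ) = begin
    ind ((c ≁ d) ∧ avoids c κ) * (x d * weight x κ)
      ≈⟨ *-congʳ (ind-∧ (c ≁ d) (avoids c κ)) ⟩
    ind (c ≁ d) * ind (avoids c κ) * (x d * weight x κ)
      ≈⟨ solve 4 (λ i a x w → i :* a :* (x :* w) := i :* x :* (a :* w)) refl (ind (c ≁ d)) (ind (avoids c κ)) (x d) (weight x κ) ⟩
    ind (c ≁ d) * x d * (ind (avoids c κ) * weight x κ)
      ≈⟨ *-cong (trans (*-congʳ (reflexive (≡.cong ind (≁-sym c d)))) delete) (weight-∖ x c κ) ⟩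
    (x ∖ c) d * weight (x ∖ c) κ ∎
    where
    delete : ind (d ≁ c) * x d ≈ (x ∖ c) d
    delete with does (d ≟ c)
    ... | true  = zeroˡ _
    ... | false = *-identityˡ _

  -- Induction on the number of vertices: the colour c of the first vertex is deleted for the
  -- others, and `sum-elem-∖` contributes the factor n + 1 that raises n! to (n + 1)!.
  sum-distinct : ∀ n (x : Fin L → Carrier) →
    sumVec {n} (λ κ → ind (distinct κ) * weight x κ) ≈ (n !) ·ₙ elem x n
  sum-distinct zero    x = trans (*-identityˡ _) (sym (trans (+-identityʳ _) (elem-0 x)))
    where
    elem-0 : ∀ {m} (y : Fin m → Carrier) → elem y 0 ≈ 1#
    elem-0 {zero}  y = refl
    elem-0 {suc m} y = trans (linear-⊛ (y zero) (elem (y ∘ suc)) 0) (trans (+-identityʳ _) (elem-0 (y ∘ suc)))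
  sum-distinct (suc n) x = begin
    ∑[ c < L ] sumVec {n} (λ κ → ind (avoids c κ ∧ distinct κ) * (x c * weight x κ))
      ≈⟨ sum-cong-≋ (λ c → trans (sumVec-cong (λ κ → entry c κ))
           (trans (sym (*-distribˡ-sumVec {n} (x c) (λ κ → ind (distinct κ) * weight (x ∖ c) κ))) (*-congˡ (sum-distinct n (x ∖ c))))) ⟩
    ∑[ c < L ] (x c * ((n !) ·ₙ elem (x ∖ c) n))
      ≈⟨ sum-cong-≋ (λ c → trans (×-comm-* (n !) (x c) (elem (x ∖ c) n)) (×-as-* (n !) _)) ⟩
    ∑[ c < L ] ((n !) ·ₙ 1# * (x c * elem (x ∖ c) n))
      ≈⟨ trans (×-as-* (n !) _) (*-distribˡ-sum {L} ((n !) ·ₙ 1#) (λ c → x c * elem (x ∖ c) n)) ⟨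
    (n !) ·ₙ (∑[ c < L ] (x c * elem (x ∖ c) n))
      ≈⟨ ×-congʳ (n !) (sum-elem-∖ x n) ⟩
    (n !) ·ₙ (suc n ·ₙ elem x (suc n))
      ≈⟨ ×-assocˡ _ (n !) (suc n) ⟩
    ((n !) ℕ.* suc n) ·ₙ elem x (suc n)
      ≡⟨ ≡.cong (_·ₙ elem x (suc n)) (ℕₚ.*-comm (n !) (suc n)) ⟩
    (suc n !) ·ₙ elem x (suc n) ∎
    where
    ×-as-* : ∀ m a → m ·ₙ a ≈ m ·ₙ 1# * a
    ×-as-* m a = sym (trans (SemiringMult.×-assoc-* semiring m 1# a) (×-congʳ m (*-identityˡ a)))
    entry : ∀ c (κ : Vec (Fin L) n) → ind (avoids c κ ∧ distinct κ) * (x c * weight x κ)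
      ≈ x c * (ind (distinct κ) * weight (x ∖ c) κ)
    entry c κ = begin
      ind (avoids c κ ∧ distinct κ) * (x c * weight x κ)
        ≈⟨ *-congʳ (ind-∧ (avoids c κ) (distinct κ)) ⟩
      ind (avoids c κ) * ind (distinct κ) * (x c * weight x κ)
        ≈⟨ solve 4 (λ a d x w → a :* d :* (x :* w) := x :* (d :* (a :* w))) refl (ind (avoids c κ)) (ind (distinct κ)) (x c) (weight x κ) ⟩
      x c * (ind (distinct κ) * (ind (avoids c κ) * weight x κ))
        ≈⟨ *-congˡ (*-congˡ (weight-∖ x c κ)) ⟩
      x c * (ind (distinct κ) * weight (x ∖ c) κ) ∎

  -- Writing the second vertex as `punchIn i j` lets its colour d be inserted before the colour c of
  -- i. The m other vertices are coloured injectively avoiding c and d, so `sum-distinct` applies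
  -- with both variables deleted.
  rootedAt-Complete : ∀ m (x : Fin L → Carrier) i j F c →
    rootedAt x (Complete (suc (suc m))) i (punchIn i j) F c
      ≈ ∑[ d < L ] (ind (c ≁ d) * (x d * F d * ((m !) ·ₙ elem ((x ∖ c) ∖ d) m)))
  rootedAt-Complete m x i j F c = trans
    (sumVec-insertAt {m} j (λ κ → ind (proper (Complete (suc (suc m))) (insertAt κ i c)) * (weight x κ * F (lookup (insertAt κ i c) (punchIn i j)))))
    (sum-cong-≋ (λ d → begin
      sumVec (λ κ → ind (proper (Complete (suc (suc m))) (κ₂ d κ)) * (weight x (insertAt κ j d) * F (lookup (κ₂ d κ) (punchIn i j))))
        ≈⟨ sumVec-cong (entry d) ⟩
      sumVec {m} (λ κ → ind (c ≁ d) * (x d * F d) * (ind (distinct κ) * weight ((x ∖ c) ∖ d) κ))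
        ≈⟨ *-distribˡ-sumVec {m} (ind (c ≁ d) * (x d * F d)) (λ κ → ind (distinct κ) * weight ((x ∖ c) ∖ d) κ) ⟨
      ind (c ≁ d) * (x d * F d) * sumVec {m} (λ κ → ind (distinct κ) * weight ((x ∖ c) ∖ d) κ)
        ≈⟨ trans (*-congˡ (sum-distinct m ((x ∖ c) ∖ d))) (*-assoc _ _ _) ⟩
      ind (c ≁ d) * (x d * F d * ((m !) ·ₙ elem ((x ∖ c) ∖ d) m)) ∎))
    where
    κ₂ : Fin L → Vec (Fin L) m → Vec (Fin L) (suc (suc m))
    κ₂ d κ = insertAt (insertAt κ j d) i c
    factors : ∀ d (κ : Vec (Fin L) m) → proper (Complete (suc (suc m))) (κ₂ d κ)
      ≡ (c ≁ d) ∧ (avoids c κ ∧ (avoids d κ ∧ distinct κ))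
    factors d κ = ≡.trans (proper-Complete (κ₂ d κ)) (≡.trans (distinct-insertAt (insertAt κ j d) i c)
      (≡.trans (≡.cong₂ _∧_ (avoids-insertAt c κ j d) (distinct-insertAt κ j d)) (∧-assoc (c ≁ d) (avoids c κ) _)))
    ind-factors : ∀ d (κ : Vec (Fin L) m) → ind (proper (Complete (suc (suc m))) (κ₂ d κ))
      ≈ ind (c ≁ d) * (ind (avoids c κ) * (ind (avoids d κ) * ind (distinct κ)))
    ind-factors d κ = trans (reflexive (≡.cong ind (factors d κ))) (trans (ind-∧ (c ≁ d) _) (*-congˡ
      (trans (ind-∧ (avoids c κ) _) (*-congˡ (ind-∧ (avoids d κ) (distinct κ))))))
    entry : ∀ d (κ : Vec (Fin L) m) →
      ind (proper (Complete (suc (suc m))) (κ₂ d κ)) * (weight x (insertAt κ j d) * F (lookup (κ₂ d κ) (punchIn i j)))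
        ≈ ind (c ≁ d) * (x d * F d) * (ind (distinct κ) * weight ((x ∖ c) ∖ d) κ)
    entry d κ = begin
      ind (proper (Complete (suc (suc m))) (κ₂ d κ)) * (weight x (insertAt κ j d) * F (lookup (κ₂ d κ) (punchIn i j)))
        ≈⟨ *-cong (ind-factors d κ) (*-cong (weight-insertAt x κ j d)
             (reflexive (≡.cong F (≡.trans (insertAt-punchIn (insertAt κ j d) i c j) (insertAt-lookup κ j d))))) ⟩
      ind (c ≁ d) * (ind (avoids c κ) * (ind (avoids d κ) * ind (distinct κ))) * (x d * weight x κ * F d)
        ≈⟨ solve 7 (λ p a b q x w F → p :* (a :* (b :* q)) :* (x :* w :* F) := p :* (x :* F) :* (q :* (b :* (a :* w)))) refl
             (ind (c ≁ d)) (ind (avoids c κ)) (ind (avoids d κ)) (ind (distinct κ)) (x d) (weight x κ) (F d) ⟩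
      ind (c ≁ d) * (x d * F d) * (ind (distinct κ) * (ind (avoids d κ) * (ind (avoids c κ) * weight x κ)))
        ≈⟨ *-congˡ (*-congˡ (trans (*-congˡ (weight-∖ x c κ)) (weight-∖ (x ∖ c) d κ))) ⟩
      ind (c ≁ d) * (x d * F d) * (ind (distinct κ) * weight ((x ∖ c) ∖ d) κ) ∎

-- The chromatic functions of the graphs in the theorem.

module Chromatic (R : CommutativeRing 0ℓ 0ℓ) {L : ℕ} (x : Fin L → CommutativeRing.Carrier R) where
  open CommutativeRing R hiding (zero)
  open Indicator R
  open Elementary R
  open Colourings R {L}
  open Clique R {L}
  open Transfer R x
  open Identity R x using (totals; P; Q; Q-coefficient)
  open SemiringMult semiring using (×-congʳ; ×-assoc-*) renaming (_×_ to _·ₙ_)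
  open SemiringSolver commutativeSemiring using (solve; _:=_; _:*_)
  open SetoidReasoning setoid

  chromatic : ∀ {n} → Graph n → Carrier
  chromatic {n} G = sumVec {n} (λ κ → ind (proper G κ) * weight x κ)

  chromatic-at : ∀ {n} (G : Graph n) r → chromatic G ≈ chromaticAt x G r (λ _ → 1#)
  chromatic-at {n} G r = sumVec-cong {n} (λ κ → *-congˡ (sym (*-identityʳ _)))

  chromatic-Pk-at : ∀ {a b} (G : Graph (suc a)) u (H : Graph (suc b)) v k →
    chromatic (Pk G u H v k) ≈ chromaticAt x G u (T^ k (rooted x H v))
  chromatic-Pk-at G u H v k = trans (chromatic-at (Pk G u H v k) (PkEmbR u v k v)) (chromaticAt-Pk x G u H v k v (λ _ → 1#))

  chromatic-Pk : ∀ {a b} (G : Graph (suc a)) u (H : Graph (suc b)) v k →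
    chromatic (Pk G u H v k) ≈ ⟨ T^ k (rooted x G u) ∣ rooted x H v ⟩
  chromatic-Pk G u H v k = trans (chromatic-Pk-at G u H v k)
    (trans (chromaticAt-rooted x G u (T^ k (rooted x H v))) (T^-adjoint x k (rooted x G u) (rooted x H v)))

  -- The rooted weight of a single vertex is 1, which reduces the pairing to `total`.
  chromatic-Tail : ∀ {a} (G : Graph (suc a)) u k → chromatic (Tail G u k) ≈ total (T^ k (rooted x G u))
  chromatic-Tail G u k = trans (chromatic-Pk G u K1 zero k)
    (sum-cong-≋ {L} (λ c → *-congˡ (trans (*-congˡ (trans (*-identityˡ _) (*-identityˡ _))) (*-identityʳ _))))

  module _ {p q : ℕ} (G : Graph (suc p)) (u : Fin (suc p)) (H : Graph (suc q)) (v : Fin (suc q)) (g h : ℕ) where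
    F K : Fin L → Carrier
    F = T^ g (rooted x G u)
    K = T^ h (rooted x H v)

    -- H with its path is the boundary weight K at the clique vertex j. The clique and the path of
    -- length g turn it into a weight at u, and adjointness moves `T^ g` over to G.
    chromatic-Kgh : ∀ m (i j : Fin (suc (suc m))) → i ≢ j →
      chromatic (Kgh m G u H v i j g h) ≈ (m !) ·ₙ Q F K m
    chromatic-Kgh m i j i≢j = begin
      chromatic (Kgh m G u H v i j g h)
        ≈⟨ chromatic-Pk-at (Pk G u (Complete (suc (suc m))) i g) (PkEmbR u i g j) H v h ⟩
      chromaticAt x (Pk G u (Complete (suc (suc m))) i g) (PkEmbR u i g j) K
        ≈⟨ chromaticAt-Pk x G u (Complete (suc (suc m))) i g j K ⟩
      chromaticAt x G u (T^ g (rootedAt x (Complete (suc (suc m))) i j K))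
        ≈⟨ chromaticAt-rooted x G u (T^ g (rootedAt x (Complete (suc (suc m))) i j K)) ⟩
      ⟨ rooted x G u ∣ T^ g (rootedAt x (Complete (suc (suc m))) i j K) ⟩
        ≈⟨ T^-adjoint x g (rooted x G u) (rootedAt x (Complete (suc (suc m))) i j K) ⟩
      ⟨ F ∣ rootedAt x (Complete (suc (suc m))) i j K ⟩
        -- As i and j differ, j has the form `punchIn i _` required by `rootedAt-Complete`.
        ≡⟨ ≡.cong (λ w → ⟨ F ∣ rootedAt x (Complete (suc (suc m))) i w K ⟩) (punchIn-punchOut i≢j) ⟨
      ⟨ F ∣ rootedAt x (Complete (suc (suc m))) i (punchIn i (punchOut i≢j)) K ⟩
        ≈⟨ sum-cong-≋ (λ c → row c) ⟩
      ∑[ c < L ] (m!# * ∑[ d < L ] (ind (c ≁ d) * (x c * F c * (x d * K d) * elem ((x ∖ c) ∖ d) m)))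
        ≈⟨ *-distribˡ-sum {L} m!# _ ⟨
      m!# * Q F K m
        ≈⟨ trans (×-assoc-* (m !) 1# (Q F K m)) (×-congʳ (m !) (*-identityˡ _)) ⟩
      (m !) ·ₙ Q F K m ∎
      where
      m!# : Carrier
      m!# = (m !) ·ₙ 1#
      row : ∀ c → x c * (F c * rootedAt x (Complete (suc (suc m))) i (punchIn i (punchOut i≢j)) K c)
        ≈ m!# * ∑[ d < L ] (ind (c ≁ d) * (x c * F c * (x d * K d) * elem ((x ∖ c) ∖ d) m))
      row c = begin
        x c * (F c * rootedAt x (Complete (suc (suc m))) i (punchIn i (punchOut i≢j)) K c)
          ≈⟨ trans (sym (*-assoc _ _ _)) (*-congˡ (rootedAt-Complete m x i (punchOut i≢j) K c)) ⟩
        x c * F c * ∑[ d < L ] (ind (c ≁ d) * (x d * K d * ((m !) ·ₙ elem ((x ∖ c) ∖ d) m)))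
          ≈⟨ *-distribˡ-sum {L} (x c * F c) _ ⟩
        ∑[ d < L ] (x c * F c * (ind (c ≁ d) * (x d * K d * ((m !) ·ₙ elem ((x ∖ c) ∖ d) m))))
          ≈⟨ sum-cong-≋ (λ d → trans (*-congˡ (*-congˡ (*-congˡ (sym (trans (×-assoc-* (m !) 1# _) (×-congʳ (m !) (*-identityˡ _)))))))
               (solve 5 (λ a i b k e → a :* (i :* (b :* (k :* e))) := k :* (i :* (a :* b :* e))) refl
                 (x c * F c) (ind (c ≁ d)) (x d * K d) m!# (elem ((x ∖ c) ∖ d) m))) ⟩
        ∑[ d < L ] (m!# * (ind (c ≁ d) * (x c * F c * (x d * K d) * elem ((x ∖ c) ∖ d) m)))
          ≈⟨ *-distribˡ-sum {L} m!# _ ⟨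
        m!# * ∑[ d < L ] (ind (c ≁ d) * (x c * F c * (x d * K d) * elem ((x ∖ c) ∖ d) m)) ∎

    pathSeries : Series
    pathSeries z = chromatic (Pk G u H v (g ℕ.+ h ℕ.+ z))

    tailSeriesˡ tailSeriesʳ : Series
    tailSeriesˡ b = chromatic (Tail G u (b ℕ.+ g))
    tailSeriesʳ c = chromatic (Tail H v (c ℕ.+ h))

    -- Adjointness returns `T^ h` from K to the side of G, where the three path lengths add up.
    pathSeries-P : P F K ≋ pathSeries
    pathSeries-P z = begin
      ⟨ T^ z F ∣ K ⟩
        ≈⟨ T^-adjoint x h (T^ z F) (rooted x H v) ⟩
      ⟨ T^ h (T^ z F) ∣ rooted x H v ⟩
        ≈⟨ ⟨∣⟩-cong x (λ c → trans (T^-+ x h (z ℕ.+ g) (rooted x G u) c) (T^-cong x h (T^-+ x z g (rooted x G u)) c)) (λ _ → refl) ⟨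
      ⟨ T^ (h ℕ.+ (z ℕ.+ g)) (rooted x G u) ∣ rooted x H v ⟩
        ≡⟨ ≡.cong (λ k → ⟨ T^ k (rooted x G u) ∣ rooted x H v ⟩)
             (+-*-Solver.solve 3 (λ h z g → h +-*-Solver.:+ (z +-*-Solver.:+ g) +-*-Solver.:= g +-*-Solver.:+ h +-*-Solver.:+ z) ≡.refl h z g) ⟩
      ⟨ T^ (g ℕ.+ h ℕ.+ z) (rooted x G u) ∣ rooted x H v ⟩
        ≈⟨ chromatic-Pk G u H v (g ℕ.+ h ℕ.+ z) ⟨
      pathSeries z ∎

    tailSeries-total : ∀ {a} (G : Graph (suc a)) u g → totals (T^ g (rooted x G u)) ≋ λ b → chromatic (Tail G u (b ℕ.+ g))
    tailSeries-total G u g b = sym (trans (chromatic-Tail G u (b ℕ.+ g)) (sum-cong-≋ {L} (λ c → *-congˡ (T^-+ x b g (rooted x G u) c))))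

    chromatic-Kgh-expansion : ∀ m (i j : Fin (suc (suc m))) → i ≢ j →
      chromatic (Kgh m G u H v i j g h)
        ≈ (m !) ·ₙ ((elem x ⊛ θ pathSeries) (suc m)
            + m ·ₙ ((θ (elem x) S.- elem x) ⊛ (tailSeriesˡ ⊛ tailSeriesʳ)) m)
    chromatic-Kgh-expansion m i j i≢j = trans (chromatic-Kgh m i j i≢j) (×-congʳ (m !)
      (trans (Q-coefficient F K m) (+-cong
        (⊛-cong {elem x} (λ _ → refl) (θ-cong pathSeries-P) (suc m))
        (×-congʳ m (⊛-cong {θ (elem x) S.- elem x} (λ _ → refl)
          (⊛-cong (tailSeries-total G u g) (tailSeries-total H v h)) m)))))

-- Extraction of coefficients

open import Defs using (X; e)
open import Data.Integer as ℤ using (ℤ; +_)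
import Data.Integer.Properties as ℤₚ

module ListSum (R : CommutativeRing 0ℓ 0ℓ) where
  open CommutativeRing R hiding (zero)
  open PowerSeries R using (_⊛_)
  open SetoidReasoning setoid

  Σ[_]_ : List A → (A → Carrier) → Carrier
  Σ[ xs ] f = foldr (λ i acc → f i + acc) 0# xs

  Σ-cong : ∀ {f g : A → Carrier} xs → (∀ i → f i ≈ g i) → Σ[ xs ] f ≈ Σ[ xs ] g
  Σ-cong []       p = refl
  Σ-cong (x ∷ xs) p = +-cong (p x) (Σ-cong xs p)

  *-distribˡ-Σ : ∀ a (xs : List A) f → a * (Σ[ xs ] f) ≈ Σ[ xs ] (λ i → a * f i)
  *-distribˡ-Σ a []       f = zeroʳ a
  *-distribˡ-Σ a (x ∷ xs) f = trans (distribˡ _ _ _) (+-congˡ (*-distribˡ-Σ a xs f))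

  Σ-++ : ∀ (xs ys : List A) f → Σ[ xs ++ ys ] f ≈ Σ[ xs ] f + Σ[ ys ] f
  Σ-++ []       ys f = sym (+-identityˡ _)
  Σ-++ (x ∷ xs) ys f = trans (+-congˡ (Σ-++ xs ys f)) (sym (+-assoc _ _ _))

  Σ-map : ∀ (h : A → B) xs f → Σ[ map h xs ] f ≈ Σ[ xs ] (f ∘ h)
  Σ-map h []       f = refl
  Σ-map h (x ∷ xs) f = +-congˡ (Σ-map h xs f)

  Σ-concatMap : ∀ (h : A → List B) xs f → Σ[ concatMap h xs ] f ≈ Σ[ xs ] (λ i → Σ[ h i ] f)
  Σ-concatMap h []       f = refl
  Σ-concatMap h (x ∷ xs) f = trans (Σ-++ (h x) (concatMap h xs) f) (+-congˡ (Σ-concatMap h xs f))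

  Σ-upTo-suc : ∀ n f → Σ[ upTo (suc n) ] f ≈ f 0 + Σ[ upTo n ] (f ∘ suc)
  Σ-upTo-suc n f = +-congˡ (trans (reflexive (≡.cong (λ xs → Σ[ xs ] f) (≡.sym (map-applyUpTo (λ i → i) suc n))))
    (Σ-map suc (upTo n) f))

  ⊛-as-Σ : ∀ f g n → (f ⊛ g) n ≈ Σ[ upTo (suc n) ] (λ i → f i * g (n ∸ i))
  ⊛-as-Σ f g zero    = sym (+-identityʳ _)
  ⊛-as-Σ f g (suc n) = trans (+-congˡ (⊛-as-Σ (f ∘ suc) g n)) (sym (Σ-upTo-suc (suc n) (λ i → f i * g (suc n ∸ i))))

-- The head of an exponent list is the exponent of the outermost variable.
Λ : ℕ → CommutativeRing 0ℓ 0ℓ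
Λ zero    = ℤₚ.+-*-commutativeRing
Λ (suc L) = PowerSeries.series (Λ L)

module Λ (L : ℕ) = CommutativeRing (Λ L)

vars : ∀ L → Fin L → Λ.Carrier L
vars (suc L) zero    = PowerSeries.var (Λ L)
vars (suc L) (suc c) = PowerSeries.const (Λ L) (vars L c)

coeff : ∀ L → Λ.Carrier L → List ℕ → ℤ
coeff zero    F α       = F
-- A default for lists that are too short; `⟦⟧-coeff` compares only lists of length L.
coeff (suc L) F []      = + 0
coeff (suc L) F (k ∷ α) = coeff L (F k) α

coeff-cong : ∀ L {F G : Λ.Carrier L} → Λ._≈_ L F G → ∀ α → coeff L F α ≡ coeff L G α
coeff-cong zero    p α       = p
coeff-cong (suc L) p []      = ≡.refl
coeff-cong (suc L) p (k ∷ α) = coeff-cong L (p k) α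

coeff-+ : ∀ L (F G : Λ.Carrier L) α → coeff L (Λ._+_ L F G) α ≡ coeff L F α ℤ.+ coeff L G α
coeff-+ zero    F G α       = ≡.refl
coeff-+ (suc L) F G []      = ≡.refl
coeff-+ (suc L) F G (k ∷ α) = coeff-+ L (F k) (G k) α

coeff-0 : ∀ L α → coeff L (Λ.0# L) α ≡ + 0
coeff-0 zero    α       = ≡.refl
coeff-0 (suc L) []      = ≡.refl
coeff-0 (suc L) (k ∷ α) = coeff-0 L α

-- Restriction to L variables: the coefficients at exponent lists of length L, curried into iterated
-- series.
⟦_⟧ : SF → ∀ L → Λ.Carrier L
⟦ f ⟧ zero    = f []
⟦ f ⟧ (suc L) = λ k → ⟦ (λ α → f (k ∷ α)) ⟧ L

⟦⟧-cong : ∀ {f g : SF} L → (∀ α → length α ≡ L → f α ≡ g α) → Λ._≈_ L (⟦ f ⟧ L) (⟦ g ⟧ L)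
⟦⟧-cong zero    p   = p [] ≡.refl
⟦⟧-cong (suc L) p k = ⟦⟧-cong L (λ α eq → p (k ∷ α) (≡.cong suc eq))

-- The coefficient at α is already visible in `length α` variables, so each coefficient of the
-- theorem reduces to an identity in one ring.
⟦⟧-injective : ∀ {f g : SF} α → Λ._≈_ (length α) (⟦ f ⟧ (length α)) (⟦ g ⟧ (length α)) → f α ≡ g α
⟦⟧-injective []      p = p
⟦⟧-injective (k ∷ α) p = ⟦⟧-injective α (p k)

⟦⟧-coeff : ∀ {f : SF} L (F : Λ.Carrier L) → (∀ α → length α ≡ L → f α ≡ coeff L F α) → Λ._≈_ L (⟦ f ⟧ L) F
⟦⟧-coeff zero    F p   = p [] ≡.refl
⟦⟧-coeff (suc L) F p k = ⟦⟧-coeff L (F k) (λ α eq → p (k ∷ α) (≡.cong suc eq))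

⟦⟧-⊕ : ∀ f g L → Λ._≈_ L (⟦ f ⊕ g ⟧ L) (Λ._+_ L (⟦ f ⟧ L) (⟦ g ⟧ L))
⟦⟧-⊕ f g zero    = ≡.refl
⟦⟧-⊕ f g (suc L) = λ k → ⟦⟧-⊕ (f ∘ (k ∷_)) (g ∘ (k ∷_)) L

⟦⟧-zeroSF : ∀ L → Λ._≈_ L (⟦ zeroSF ⟧ L) (Λ.0# L)
⟦⟧-zeroSF zero    = ≡.refl
⟦⟧-zeroSF (suc L) = λ k → ⟦⟧-zeroSF L

⟦⟧-neg : ∀ f L → Λ._≈_ L (⟦ (λ α → ℤ.- f α) ⟧ L) (Λ.-_ L (⟦ f ⟧ L))
⟦⟧-neg f zero    = ≡.refl
⟦⟧-neg f (suc L) = λ k → ⟦⟧-neg (f ∘ (k ∷_)) L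

⟦⟧-ΣSF : ∀ (xs : List A) (f : A → SF) L →
  Λ._≈_ L (⟦ ΣSF xs f ⟧ L) (ListSum.Σ[_]_ (Λ L) xs (λ i → ⟦ f i ⟧ L))
⟦⟧-ΣSF []       f L = ⟦⟧-zeroSF L
⟦⟧-ΣSF (x ∷ xs) f L = Λ.trans L (⟦⟧-⊕ (f x) (ΣSF xs f) L) (Λ.+-congˡ L (⟦⟧-ΣSF xs f L))

module Multiple (L : ℕ) where
  open SemiringMult (Λ.semiring L) public using (×-congʳ; ×-assoc-*) renaming (_×_ to _·ₙ_)

⟦⟧-·ₙ : ∀ n f L → Λ._≈_ L (⟦ (+ n) · f ⟧ L) (Multiple._·ₙ_ L n (⟦ f ⟧ L))
⟦⟧-·ₙ zero    f L = Λ.trans L (⟦⟧-cong L (λ α _ → ℤₚ.*-zeroˡ (f α))) (⟦⟧-zeroSF L)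
⟦⟧-·ₙ (suc n) f L = Λ.trans L
  (⟦⟧-cong L (λ α _ → ℤₚ.suc-* (+ n) (f α)))
  (Λ.trans L (⟦⟧-⊕ f ((+ n) · f) L) (Λ.+-congˡ L (⟦⟧-·ₙ n f L)))

⟦⟧-·-pred : ∀ n f L → Λ._≈_ L (⟦ ((+ n) ℤ.- (+ 1)) · f ⟧ L)
  (Λ._-_ L (Multiple._·ₙ_ L n (⟦ f ⟧ L)) (⟦ f ⟧ L))
⟦⟧-·-pred n f L = Λ.trans L
  (⟦⟧-cong L (λ α _ → ≡.trans (ℤₚ.*-distribʳ-+ (f α) (+ n) (ℤ.- (+ 1)))
    (≡.cong (λ z → (+ n) ℤ.* f α ℤ.+ z) (ℤₚ.-1*i≡-i (f α)))))
  (Λ.trans L (⟦⟧-⊕ ((+ n) · f) (λ α → ℤ.- f α) L) (Λ.+-cong L (⟦⟧-·ₙ n f L) (⟦⟧-neg f L)))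

-- Grouping the splittings of the exponent list by their head exhibits the product as a Cauchy
-- product in the outermost variable.
⊗-∷ : ∀ f g k α → (f ⊗ g) (k ∷ α) ≡ ΣSF (upTo (suc k)) (λ i → (f ∘ (i ∷_)) ⊗ (g ∘ ((k ∸ i) ∷_))) α
⊗-∷ f g k α = go (upTo (suc k))
  where
  open ListSum ℤₚ.+-*-commutativeRing
  term : List ℕ × List ℕ → ℤ
  term p = f (proj₁ p) ℤ.* g (proj₂ p)
  h : ℕ → List (List ℕ × List ℕ)
  h i = map (λ p → (i ∷ proj₁ p) , ((k ∸ i) ∷ proj₂ p)) (splits α)
  sumℤ-map : ∀ {A : Set} (t : A → ℤ) xs → sumℤ (map t xs) ≡ Σ[ xs ] t
  sumℤ-map t []       = ≡.refl
  sumℤ-map t (x ∷ xs) = ≡.cong (λ z → t x ℤ.+ z) (sumℤ-map t xs)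
  row : ∀ i → Σ[ h i ] term ≡ ((f ∘ (i ∷_)) ⊗ (g ∘ ((k ∸ i) ∷_))) α
  row i = ≡.trans (Σ-map _ (splits α) term) (≡.sym (sumℤ-map _ (splits α)))
  collect : ∀ xs → Σ[ xs ] (λ i → Σ[ h i ] term) ≡ ΣSF xs (λ i → (f ∘ (i ∷_)) ⊗ (g ∘ ((k ∸ i) ∷_))) α
  collect []       = ≡.refl
  collect (i ∷ xs) = ≡.cong₂ ℤ._+_ (row i) (collect xs)
  go : ∀ xs → sumℤ (map term (concatMap h xs)) ≡ ΣSF xs (λ i → (f ∘ (i ∷_)) ⊗ (g ∘ ((k ∸ i) ∷_))) α
  go xs = ≡.trans (sumℤ-map term (concatMap h xs)) (≡.trans (Σ-concatMap h xs term) (collect xs))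

⟦⟧-⊗ : ∀ f g L → Λ._≈_ L (⟦ f ⊗ g ⟧ L) (Λ._*_ L (⟦ f ⟧ L) (⟦ g ⟧ L))
⟦⟧-⊗ f g zero    = ℤₚ.+-identityʳ _
⟦⟧-⊗ f g (suc L) k = begin
  ⟦ (f ⊗ g) ∘ (k ∷_) ⟧ L
    ≈⟨ ⟦⟧-cong L (λ α _ → ⊗-∷ f g k α) ⟩
  ⟦ ΣSF (upTo (suc k)) (λ i → (f ∘ (i ∷_)) ⊗ (g ∘ ((k ∸ i) ∷_))) ⟧ L
    ≈⟨ ⟦⟧-ΣSF (upTo (suc k)) (λ i → (f ∘ (i ∷_)) ⊗ (g ∘ ((k ∸ i) ∷_))) L ⟩
  Σ[ upTo (suc k) ] (λ i → ⟦ (f ∘ (i ∷_)) ⊗ (g ∘ ((k ∸ i) ∷_)) ⟧ L)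
    ≈⟨ Σ-cong (upTo (suc k)) (λ i → ⟦⟧-⊗ (f ∘ (i ∷_)) (g ∘ ((k ∸ i) ∷_)) L) ⟩
  Σ[ upTo (suc k) ] (λ i → ⟦ f ⟧ (suc L) i * ⟦ g ⟧ (suc L) (k ∸ i))
    ≈⟨ ⊛-as-Σ (⟦ f ⟧ (suc L)) (⟦ g ⟧ (suc L)) k ⟨
  (⟦ f ⟧ (suc L) ⊛ ⟦ g ⟧ (suc L)) k ∎
  where
  open CommutativeRing (Λ L) using (_*_; setoid)
  open PowerSeries (Λ L) using (_⊛_)
  open ListSum (Λ L)
  open SetoidReasoning setoid

-- Elementary symmetric functions in the iterated series ring.

module Embedding (R : CommutativeRing 0ℓ 0ℓ) where
  open CommutativeRing R hiding (zero)
  open PowerSeries R using (const; const-⊛; _≋_; series; shift)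
  module E = Elementary R
  module E′ = Elementary series

  const-* : ∀ a b → const (a * b) ≋ PowerSeries._⊛_ R (const a) (const b)
  const-* a b zero    = refl
  const-* a b (suc n) = sym (trans (const-⊛ a (const b) (suc n)) (zeroʳ a))

  elem-const : ∀ {m} (x : Fin m → Carrier) n → E′.elem (const ∘ x) n ≋ const (E.elem x n)
  elem-const {zero}  x zero    = CommutativeRing.refl series
  elem-const {zero}  x (suc n) zero    = refl
  elem-const {zero}  x (suc n) (suc k) = refl
  elem-const {suc m} x n k = trans (E′.linear-⊛ (const (x zero)) (E′.elem (const ∘ x ∘ suc)) n k)
    (trans (step n k) (sym (E.const-cong (E.linear-⊛ (x zero) (E.elem (x ∘ suc)) n) k)))
    where
    f = E.elem (x ∘ suc)
    f′ = E′.elem (const ∘ x ∘ suc)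
    step : ∀ n k → f′ n k + PowerSeries.shift series (λ i → PowerSeries._⊛_ R (const (x zero)) (f′ i)) n k
      ≈ const (f n + shift (λ i → x zero * f i) n) k
    step zero    zero    = +-congʳ (elem-const (x ∘ suc) 0 0)
    step zero    (suc k) = trans (+-congʳ (elem-const (x ∘ suc) 0 (suc k))) (+-identityʳ _)
    step (suc n) k = trans
      (+-cong (elem-const (x ∘ suc) (suc n) k)
        (trans (PowerSeries.⊛-cong R {const (x zero)} (λ _ → refl) (elem-const (x ∘ suc) n) k) (sym (const-* (x zero) (f n) k))))
      (sym (const-+ k))
      where
      const-+ : ∀ k → const (f (suc n) + x zero * f n) k ≈ const (f (suc n)) k + const (x zero * f n) k
      const-+ zero    = refl
      const-+ (suc k) = sym (+-identityʳ _)

-- This is e_a(y, x) = e_a(x) + y e_{a-1}(x) for the outermost variable y, read off by its exponent: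
-- 0 selects the first term, 1 the second, and larger exponents give zero.
⟦e⟧ : ∀ a L → Λ._≈_ L (⟦ e a ⟧ L) (Elementary.elem (Λ L) (vars L) a)
⟦e⟧ zero    zero = ≡.refl
⟦e⟧ (suc a) zero = ≡.refl
⟦e⟧ a (suc L) k = trans (expand a k) (sym (E′.linear-⊛ (vars (suc L) zero) (E′.elem (const ∘ vars L)) a k))
  where
  open CommutativeRing (Λ L) using (trans; sym; refl; _≈_; _+_; 0#; +-cong; +-congʳ; +-congˡ; +-identityʳ; +-identityˡ)
  open PowerSeries (Λ L) using (const; var; var-⊛; _⊛_; shift)
  open Embedding (Λ L)
  ê : ℕ → ℕ → CommutativeRing.Carrier (Λ L)
  ê = E′.elem (const ∘ vars L)
  vanish : ∀ {f : SF} → (∀ α → f α ≡ + 0) → ⟦ f ⟧ L ≈ 0#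
  vanish p = trans (⟦⟧-cong L (λ α _ → p α)) (⟦⟧-zeroSF L)
  no-constant : ∀ k α → e zero (suc k ∷ α) ≡ + 0
  no-constant k α = ≡.cong (if_then + 1 else + 0) (∧-zeroʳ (allᵇ (λ i → i ≤ᵇ 1) (suc k ∷ α)))
  expand : ∀ a k → ⟦ e a ⟧ (suc L) k ≈ ê a k + PowerSeries.shift (PowerSeries.series (Λ L)) (λ i → var ⊛ ê i) a k
  expand zero zero = sym (trans (+-identityʳ _) (trans (elem-const (vars L) 0 0) (sym (⟦e⟧ 0 L))))
  expand zero (suc k) = trans (vanish (no-constant k)) (sym (trans (+-identityʳ _) (elem-const (vars L) 0 (suc k))))
  expand (suc a) zero = sym (trans (+-congˡ (var-⊛ (ê a) 0)) (trans (+-identityʳ _) (trans (elem-const (vars L) (suc a) 0) (sym (⟦e⟧ (suc a) L)))))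
  expand (suc a) (suc zero) = sym (trans
    (+-cong (elem-const (vars L) (suc a) 1) (trans (var-⊛ (ê a) 1) (trans (elem-const (vars L) a 0) (sym (⟦e⟧ a L)))))
    (+-identityˡ _))
  expand (suc a) (suc (suc k)) = trans (vanish (λ _ → ≡.refl)) (sym (trans
    (+-cong (elem-const (vars L) (suc a) (suc (suc k))) (trans (var-⊛ (ê a) (suc (suc k))) (elem-const (vars L) a (suc k))))
    (+-identityˡ _)))

-- Monomials of colourings and the coefficients of chromatic functions.

δ : ∀ {L} → Fin L → Fin L → ℕ
δ c i = if does (c ≟ i) then 1 else 0

multiplicity : ∀ {L n} → Vec (Fin L) n → Fin L → ℕ
multiplicity []      i = 0
multiplicity (c ∷ κ) i = δ c i ℕ.+ multiplicity κ i

monomial : ∀ L → (Fin L → ℕ) → Λ.Carrier L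
monomial zero    β = Λ.1# zero
monomial (suc L) β k = if k ≡ᵇ β zero then monomial L (β ∘ suc) else Λ.0# L

monomial-0 : ∀ L → Λ._≈_ L (monomial L (λ _ → 0)) (Λ.1# L)
monomial-0 zero            = ≡.refl
monomial-0 (suc L) zero    = monomial-0 L
monomial-0 (suc L) (suc k) = Λ.refl L

var-monomial : ∀ L c β → Λ._≈_ L (Λ._*_ L (vars L c) (monomial L β)) (monomial L (λ i → δ c i ℕ.+ β i))
var-monomial (suc L) zero β k = Λ.trans L (PowerSeries.var-⊛ (Λ L) (monomial (suc L) β) k) (step k)
  where
  step : ∀ k → Λ._≈_ L (PowerSeries.shift (Λ L) (monomial (suc L) β) k) (monomial (suc L) (λ i → δ zero i ℕ.+ β i) k)
  step zero    = Λ.refl L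
  step (suc k) = Λ.refl L
var-monomial (suc L) (suc c) β k = Λ.trans L (PowerSeries.const-⊛ (Λ L) (vars L c) (monomial (suc L) β) k) step
  where
  step : Λ._≈_ L (Λ._*_ L (vars L c) (monomial (suc L) β k)) (monomial (suc L) (λ i → δ (suc c) i ℕ.+ β i) k)
  step with k ≡ᵇ β zero
  ... | true  = var-monomial L c (β ∘ suc)
  ... | false = Λ.zeroʳ L (vars L c)

weight-monomial : ∀ L {n} (κ : Vec (Fin L) n) →
  Λ._≈_ L (Colourings.weight (Λ L) (vars L) κ) (monomial L (multiplicity κ))
weight-monomial L []      = Λ.sym L (monomial-0 L)
weight-monomial L (c ∷ κ) = Λ.trans L (Λ.*-congˡ L (weight-monomial L κ)) (var-monomial L c (multiplicity κ))

coeff-monomial : ∀ α (β : Fin (length α) → ℕ) →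
  coeff (length α) (monomial (length α) β) α
    ≡ (if allᵇ (λ i → β i ≡ᵇ List.lookup α i) (allFin (length α)) then + 1 else + 0)
coeff-monomial []      β = ≡.refl
coeff-monomial (k ∷ α) β = ≡.trans head-exponent
  (≡.cong (if_then + 1 else + 0) (≡.sym (allᵇ-allFin-suc (λ i → β i ≡ᵇ List.lookup (k ∷ α) i))))
  where
  -- The test in `monomial` has the prescribed exponent on the right, the test in `fibresOK` on the
  -- left.
  ≡ᵇ-sym : ∀ m n → (m ≡ᵇ n) ≡ (n ≡ᵇ m)
  ≡ᵇ-sym zero    zero    = ≡.refl
  ≡ᵇ-sym zero    (suc n) = ≡.refl
  ≡ᵇ-sym (suc m) zero    = ≡.refl
  ≡ᵇ-sym (suc m) (suc n) = ≡ᵇ-sym m n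
  head-exponent : coeff (length α) (monomial (suc (length α)) β k) α
    ≡ (if (β zero ≡ᵇ k) ∧ allᵇ (λ i → β (suc i) ≡ᵇ List.lookup α i) (allFin (length α)) then + 1 else + 0)
  head-exponent rewrite ≡ᵇ-sym (β zero) k with k ≡ᵇ β zero
  ... | true  = coeff-monomial α (β ∘ suc)
  ... | false = coeff-0 (length α) α

open ListSum ℤₚ.+-*-commutativeRing using ()
  renaming (Σ[_]_ to ℤΣ[_]_; Σ-cong to ℤΣ-cong; Σ-map to ℤΣ-map; Σ-concatMap to ℤΣ-concatMap)

countᵇ-Σ : ∀ (p : A → Bool) xs → + countᵇ p xs ≡ ℤΣ[ xs ] (λ x → if p x then + 1 else + 0)
countᵇ-Σ p []       = ≡.refl
countᵇ-Σ p (x ∷ xs) with p x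
... | true  = ≡.cong (λ z → + 1 ℤ.+ z) (countᵇ-Σ p xs)
... | false = ≡.trans (countᵇ-Σ p xs) (≡.sym (ℤₚ.+-identityˡ _))

countᵇ-map : ∀ (p : B → Bool) (f : A → B) xs → countᵇ p (map f xs) ≡ countᵇ (p ∘ f) xs
countᵇ-map p f []       = ≡.refl
countᵇ-map p f (x ∷ xs) with p (f x)
... | true  = ≡.cong suc (countᵇ-map p f xs)
... | false = countᵇ-map p f xs

countᵇ-multiplicity : ∀ {L n} (κ : Vec (Fin L) n) i →
  countᵇ (λ w → does (lookup κ w ≟ i)) (allFin n) ≡ multiplicity κ i
countᵇ-multiplicity         []      i = ≡.refl
countᵇ-multiplicity {n = suc n} (c ∷ κ) i = ≡.trans head-count (≡.cong (δ c i ℕ.+_) tail-count)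
  where
  hit : Fin (suc n) → Bool
  hit w = does (lookup (c ∷ κ) w ≟ i)
  head-count : countᵇ hit (allFin (suc n)) ≡ δ c i ℕ.+ countᵇ hit (List.tabulate suc)
  head-count with does (c ≟ i)
  ... | true  = ≡.refl
  ... | false = ≡.refl
  tail-count : countᵇ hit (List.tabulate suc) ≡ multiplicity κ i
  tail-count = ≡.trans (≡.cong (countᵇ hit) (≡.sym (map-tabulate (λ j → j) suc)))
    (≡.trans (countᵇ-map hit suc (allFin n)) (countᵇ-multiplicity κ i))

coeff-sum : ∀ L {m} (f : Fin m → Λ.Carrier L) α →
  coeff L (Indicator.sum (Λ L) f) α ≡ ℤΣ[ allFin m ] (λ c → coeff L (f c) α)
coeff-sum L {zero}  f α = coeff-0 L α
coeff-sum L {suc m} f α = ≡.trans (coeff-+ L (f zero) _ α) (≡.cong (λ z → coeff L (f zero) α ℤ.+ z)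
  (≡.trans (coeff-sum L (f ∘ suc) α) (≡.trans (≡.sym (ℤΣ-map suc (allFin m) (λ c → coeff L (f c) α)))
    (≡.cong (λ xs → ℤΣ[ xs ] (λ c → coeff L (f c) α)) (map-tabulate (λ j → j) suc)))))

coeff-sumVec : ∀ L n (ψ : Vec (Fin L) n → Λ.Carrier L) α →
  coeff L (Colourings.sumVec (Λ L) ψ) α ≡ ℤΣ[ allVecs n L ] (λ κ → coeff L (ψ κ) α)
coeff-sumVec L zero    ψ α = ≡.sym (ℤₚ.+-identityʳ _)
coeff-sumVec L (suc n) ψ α = ≡.trans (coeff-sum L {L} _ α) (≡.trans
  (ℤΣ-cong (allFin L) (λ c → ≡.trans (coeff-sumVec L n (ψ ∘ (c ∷_)) α)
    (≡.sym (ℤΣ-map (c ∷_) (allVecs n L) (λ κ → coeff L (ψ κ) α)))))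
  (≡.sym (ℤΣ-concatMap (λ c → map (c ∷_) (allVecs n L)) (allFin L) (λ κ → coeff L (ψ κ) α))))

-- The weight of κ is the monomial of its colour multiplicities. Its coefficient at α is therefore 1
-- or 0 according to `fibresOK`, and summing over the proper κ gives the count.
⟦X⟧ : ∀ {n} (G : Graph n) L → Λ._≈_ L (⟦ X G ⟧ L) (Chromatic.chromatic (Λ L) (vars L) G)
⟦X⟧ {n} G L = ⟦⟧-coeff L _ coefficient
  where
  coefficient : ∀ α → length α ≡ L → X G α ≡ coeff L (Chromatic.chromatic (Λ L) (vars L) G) α
  coefficient α ≡.refl = ≡.trans (countᵇ-Σ _ (allVecs n L)) (≡.trans (ℤΣ-cong (allVecs n L) entry)
    (≡.sym (coeff-sumVec L n _ α)))
    where
    open Colourings (Λ L)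
    entry : ∀ κ → (if proper G κ ∧ fibresOK α κ then + 1 else + 0)
      ≡ coeff L (Λ._*_ L (Indicator.ind (Λ L) (proper G κ)) (weight (vars L) κ)) α
    entry κ with proper G κ
    ... | true  = ≡.sym (≡.trans (coeff-cong L (Λ.trans L (Λ.*-identityˡ L _) (weight-monomial L κ)) α)
      (≡.trans (coeff-monomial α (multiplicity κ)) (≡.cong (if_then + 1 else + 0)
        (allᵇ-cong (λ i → ≡.cong (_≡ᵇ List.lookup α i) (≡.sym (countᵇ-multiplicity κ i))) (allFin L)))))
    ... | false = ≡.sym (≡.trans (coeff-cong L (Λ.zeroˡ L _) α) (coeff-0 L α))

open import Data.Nat using (_+_)
open import Data.Integer using (_-_)

-- Translation of both sides of the theorem.

module Expansion {p q : ℕ} (G : Graph (suc p)) (u : Fin (suc p)) (H : Graph (suc q)) (v : Fin (suc q)) (g h L : ℕ) where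
  open CommutativeRing (Λ L) hiding (zero; _-_) renaming (_+_ to infixl 6 _⊞_; _*_ to infixl 7 _⊠_)
  open Elementary (Λ L)
  open Chromatic (Λ L) (vars L)
  open ListSum (Λ L)
  open Multiple L
  open SetoidReasoning setoid

  E Pˢ Gˢ Hˢ : Series
  E  = elem (vars L)
  Pˢ = pathSeries G u H v g h
  Gˢ = tailSeriesˡ G u H v g h
  Hˢ = tailSeriesʳ G u H v g h

  pathTerm : ℕ → ℕ → SF
  pathTerm m z = (+ z) · (e (suc m ∸ z) ⊗ X (Pk G u H v (g + h + z)))

  tailTerm : ℕ × ℕ × ℕ → SF
  tailTerm = λ { (a , b , c) → ((+ a) - (+ 1)) · ((e a ⊗ X (Tail G u (b + g))) ⊗ X (Tail H v (c + h))) }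

  ⟦paths⟧ : ∀ m → ⟦ ΣSF (applyUpTo suc (suc m)) (pathTerm m) ⟧ L ≈ (E ⊛ θ Pˢ) (suc m)
  ⟦paths⟧ m = begin
    ⟦ ΣSF (applyUpTo suc (suc m)) (pathTerm m) ⟧ L
      ≈⟨ ⟦⟧-ΣSF (applyUpTo suc (suc m)) (pathTerm m) L ⟩
    Σ[ applyUpTo suc (suc m) ] (λ z → ⟦ pathTerm m z ⟧ L)
      ≈⟨ Σ-cong (applyUpTo suc (suc m)) term ⟩
    Σ[ applyUpTo suc (suc m) ] (λ z → θ Pˢ z ⊠ E (suc m ∸ z))
      -- The convolution starts at z = 0 and the sum of the theorem at z = 1; the additional term
      -- carries the factor 0 from θ.
      ≈⟨ trans (+-congʳ (zeroˡ _)) (+-identityˡ _) ⟨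
    Σ[ upTo (suc (suc m)) ] (λ z → θ Pˢ z ⊠ E (suc m ∸ z))
      ≈⟨ ⊛-as-Σ (θ Pˢ) E (suc m) ⟨
    (θ Pˢ ⊛ E) (suc m)
      ≈⟨ ⊛-comm (θ Pˢ) E (suc m) ⟩
    (E ⊛ θ Pˢ) (suc m) ∎
    where
    term : ∀ z → ⟦ pathTerm m z ⟧ L ≈ θ Pˢ z ⊠ E (suc m ∸ z)
    term z = trans (⟦⟧-·ₙ z _ L) (trans
      (×-congʳ z (trans (⟦⟧-⊗ _ _ L) (trans (*-cong (⟦e⟧ (suc m ∸ z) L) (⟦X⟧ (Pk G u H v (g + h + z)) L)) (*-comm _ _))))
      (sym (×-assoc-* z (Pˢ z) (E (suc m ∸ z)))))

  -- The sum over `triples` is a convolution nested in a convolution, and the scalars a - 1 are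
  -- absorbed into `θ E S.- E`.
  ⟦tails⟧ : ∀ m → ⟦ ΣSF (triples m) tailTerm ⟧ L ≈ ((θ E S.- E) ⊛ (Gˢ ⊛ Hˢ)) m
  ⟦tails⟧ m = begin
    ⟦ ΣSF (triples m) tailTerm ⟧ L
      ≈⟨ ⟦⟧-ΣSF (triples m) tailTerm L ⟩
    Σ[ triples m ] t
      ≈⟨ trans (Σ-concatMap (λ i → map (λ j → i , j , (m ∸ i ∸ j)) (upTo (suc (m ∸ i)))) (upTo (suc m)) t)
           (Σ-cong (upTo (suc m)) (λ i → Σ-map (λ j → i , j , (m ∸ i ∸ j)) (upTo (suc (m ∸ i))) t)) ⟩
    Σ[ upTo (suc m) ] (λ i → Σ[ upTo (suc (m ∸ i)) ] (λ j → t (i , j , (m ∸ i ∸ j))))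
      ≈⟨ Σ-cong (upTo (suc m)) (λ i → trans (Σ-cong (upTo (suc (m ∸ i))) (λ j → term i j (m ∸ i ∸ j)))
           (trans (sym (*-distribˡ-Σ ((θ E S.- E) i) (upTo (suc (m ∸ i))) (λ j → Gˢ j ⊠ Hˢ (m ∸ i ∸ j))))
             (*-congˡ (sym (⊛-as-Σ Gˢ Hˢ (m ∸ i)))))) ⟩
    Σ[ upTo (suc m) ] (λ i → (θ E S.- E) i ⊠ (Gˢ ⊛ Hˢ) (m ∸ i))
      ≈⟨ ⊛-as-Σ (θ E S.- E) (Gˢ ⊛ Hˢ) m ⟨
    ((θ E S.- E) ⊛ (Gˢ ⊛ Hˢ)) m ∎
    where
    open RingProperties ring using (-‿distribˡ-*)
    t : ℕ × ℕ × ℕ → Carrier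
    t abc = ⟦ tailTerm abc ⟧ L
    term : ∀ a b c → t (a , b , c) ≈ (θ E S.- E) a ⊠ (Gˢ b ⊠ Hˢ c)
    term a b c = begin
      t (a , b , c)
        ≈⟨ ⟦⟧-·-pred a _ L ⟩
      a ·ₙ y′ ⊞ - y′
        ≈⟨ +-cong (×-congʳ a y′≈y) (-‿cong y′≈y) ⟩
      a ·ₙ (E a ⊠ y) ⊞ - (E a ⊠ y)
        ≈⟨ +-cong (sym (×-assoc-* a (E a) y)) (-‿distribˡ-* (E a) y) ⟩
      (a ·ₙ E a) ⊠ y ⊞ (- E a) ⊠ y
        ≈⟨ distribʳ y (a ·ₙ E a) (- E a) ⟨
      (θ E S.- E) a ⊠ y ∎
      where
      y y′ : Carrier
      y = Gˢ b ⊠ Hˢ c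
      y′ = ⟦ (e a ⊗ X (Tail G u (b + g))) ⊗ X (Tail H v (c + h)) ⟧ L
      y′≈y : y′ ≈ E a ⊠ y
      y′≈y = trans (⟦⟧-⊗ _ _ L) (trans
        (*-cong (trans (⟦⟧-⊗ _ _ L) (*-cong (⟦e⟧ a L) (⟦X⟧ (Tail G u (b + g)) L))) (⟦X⟧ (Tail H v (c + h)) L))
        (*-assoc _ _ _))

  -- Here m counts the clique vertices other than x and y, and the factorial is cleared from the
  -- denominator because coefficients are integers.
  ⟦Kgh⟧ : ∀ m x y → x ≢ y → ⟦ X (Kgh m G u H v x y g h) ⟧ L
    ≈ ⟦ (+ (m !)) · (ΣSF (applyUpTo suc (suc m)) (pathTerm m) ⊕ ((+ m) · ΣSF (triples m) tailTerm)) ⟧ L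
  ⟦Kgh⟧ m x y x≢y = begin
    ⟦ X (Kgh m G u H v x y g h) ⟧ L
      ≈⟨ ⟦X⟧ (Kgh m G u H v x y g h) L ⟩
    chromatic (Kgh m G u H v x y g h)
      ≈⟨ chromatic-Kgh-expansion G u H v g h m x y x≢y ⟩
    (m !) ·ₙ ((E ⊛ θ Pˢ) (suc m) ⊞ m ·ₙ ((θ E S.- E) ⊛ (Gˢ ⊛ Hˢ)) m)
      ≈⟨ ×-congʳ (m !) (+-cong (⟦paths⟧ m) (×-congʳ m (⟦tails⟧ m))) ⟨
    (m !) ·ₙ (⟦ paths ⟧ L ⊞ m ·ₙ ⟦ tails ⟧ L)
      ≈⟨ ×-congʳ (m !) (trans (⟦⟧-⊕ paths ((+ m) · tails) L) (+-congˡ (⟦⟧-·ₙ m tails L))) ⟨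
    (m !) ·ₙ ⟦ paths ⊕ ((+ m) · tails) ⟧ L
      ≈⟨ ⟦⟧-·ₙ (m !) (paths ⊕ ((+ m) · tails)) L ⟨
    ⟦ (+ (m !)) · (paths ⊕ ((+ m) · tails)) ⟧ L ∎
    where
    paths tails : SF
    paths = ΣSF (applyUpTo suc (suc m)) (pathTerm m)
    tails = ΣSF (triples m) tailTerm

theorem5p1 : ∀ {p q} (G : Graph (suc p)) (u : Fin (suc p)) (H : Graph (suc q)) (v : Fin (suc q))
    → Simple G → Simple H
    → (g h m' : ℕ) (x y : Fin (suc (suc m'))) → x ≢ y
    → (α : List ℕ)
    → X (Kgh m' G u H v x y g h) α
    ≡ ((+ (m' !)) · (ΣSF (applyUpTo suc (suc m')) (λ z → ((+ z) · (e (suc m' ∸ z) ⊗ X (Pk G u H v (g + h + z)))))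
    ⊕ ((+ m') · ΣSF (triples m') (λ { (a , b , c) → ((+ a) - (+ 1)) · ((e a ⊗ X (Tail G u (b + g))) ⊗ X (Tail H v (c + h))) })))) α
theorem5p1 G u H v _ _ g h m' x y x≢y α = ⟦⟧-injective α (Expansion.⟦Kgh⟧ G u H v g h (length α) m' x y x≢y)
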